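{- Let $G=3+H$ be a simple loony endgame, where $3$ denotes a 3-chain and $H$ is non-empty and composed entirely of loops (of even length at least 4). Let $f$ be the number of 4-loops in $H$ and let $c=cv(G)$. (a) If $c\ge2$ then $v(G)=c$. (b) If $c\le1$ and $v(H)=2$ then $v(G)=1$. (c) If $c\le1$, $v(H)\ne2$ and $f=0$ then $v(G)=3$. (d) If $c\le1$, $v(H)\ne2$ and $f\ge1$, let $M$ denote $G$ with all its 4-loops removed, and let $d$ be the unique integer with $0\le d\le7$ and $d\equiv v(M)\pmod 8$. If $f$ is odd then $v(G)=|4-d|$, and if $f$ is even then $v(G)=4-|4-d|$.
   Context: Game. A dots and boxes game (position) $G$ consists of a finite set of unclaimed boxes and a finite set of undrawn lines, each undrawn line bordering either exactly one box or exactly two distinct boxes, each box being bordered by at least one and at most four undrawn lines. Two players play. The player to move draws (removes) an undrawn line; every box none of whose bordering lines is still undrawn is then claimed by that player. If the move claims at least one box the same player must move again (if a line remains); otherwise the other player moves. Claiming a box when possible is not compulsory. The game ends when no line remains. Each player maximises (own boxes) minus (opponent's boxes), counting only boxes claimed from $G$ onwards. Value. $v(G)$ is the net score, under optimal play, of the player who is NOT to move in $G$. Equivalently, $v(G)=0$ if $G$ has no undrawn lines, and otherwise $v(G)=\min_m v(G;m)$ over undrawn lines $m$, where, if drawing $m$ claims $k$ boxes and leaves the position $G_m$, then $v(G;m)=v(G_m)-k$ if $k\ge1$ and $v(G;m)=-v(G_m)$ if $k=0$. Chains and loops. $G+H$ is the disjoint union. An $n$-chain (denoted $n$) has boxes $b_1,\dots,b_n$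 and lines $e_0,\dots,e_n$, where $e_i$ borders $b_i,b_{i+1}$ for $1\le i\le n-1$, $e_0$ borders only $b_1$ and $e_n$ borders only $b_n$. An $n$-loop ($n\ge4$, denoted $n_\ell$) has boxes $b_1,\dots,b_n$ and lines $e_1,\dots,e_n$, $e_i$ bordering $b_i,b_{i+1}$ (indices mod $n$). A simple loony endgame is a finite (possibly empty) disjoint union of chains of length at least 3 and loops of even length at least 4. Controlled value. If $G$ is a simple loony endgame with chains of lengths $c_i$ and loops of lengths $\ell_j$, then $fcv(G)=\sum_i(c_i-4)+\sum_j(\ell_j-8)$ and $cv(G)=fcv(G)+tb(G)$, where the terminal bonus $tb(G)$ is: $0$ if $G$ is empty; $4$ if $G$ is non-empty and has a chain of length at least 4 or has no loops; $8$ if $G$ has loops but no chains; $6$ if $G$ has both chains and loops and all its chains are 3-chains. -}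

module Defs where

open import Data.Bool.Base using (Bool; true; false; if_then_else_; _∨_)
open import Data.Empty using (⊥-elim)
open import Data.Fin.Base using (Fin; zero; suc; inject₁; fromℕ; _↑ˡ_; _↑ʳ_; splitAt; join)
import Data.Fin.Properties as Fin
open import Data.Integer.Base using (ℤ; +_; -_; _⊓_; 0ℤ) renaming (_+_ to _+ℤ_; _-_ to _-ℤ_)
open import Data.List.Base as List using (List; []; _∷_)
open import Data.List.Relation.Unary.Any as ListAny using ()
open import Data.Nat.Base using (ℕ; zero; suc; _+_; _≤_; z≤n; s≤s; NonZero; >-nonZero)
open import Data.Nat.Divisibility using (_∣_)
import Data.Nat.Properties as ℕ
open import Data.Product.Base using (_×_; _,_)
open import Data.Sum.Base as Sum using (_⊎_; inj₁; inj₂)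
open import Data.Vec.Base as Vec using (Vec; []; _∷_; _++_; allFin; count; foldr₁; removeAt; tabulate)
open import Data.Vec.Relation.Unary.Any as Any using (Any; here; there; any?)
import Data.Vec.Relation.Unary.Any.Properties as Any
open import Function.Base using (_∘_)
open import Function.Bundles using (_⇔_; mk⇔; Equivalence)
open import Relation.Binary.PropositionalEquality using (_≡_; _≢_; refl; sym; trans; cong; subst)
open import Relation.Nullary using (Dec; yes; no; does; ¬?)
open import Relation.Nullary.Decidable using (_×-dec_; _⊎-dec_; does-⇔)
open import Relation.Unary using (Decidable)

private
  variable
    b m n k : ℕ

------------------------------------------------------------------------
-- Lines and positions

data Line (b : ℕ) : Set where
  outer : Fin b → Line b
  inner : (x y : Fin b) → .(x ≢ y) → Line b

Borders : Fin b → Line b → Set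
Borders x (outer y)     = x ≡ y
Borders x (inner y z _) = x ≡ y ⊎ x ≡ z

borders? : (x : Fin b) → Decidable (Borders x)
borders? x (outer y)     = x Fin.≟ y
borders? x (inner y z _) = (x Fin.≟ y) ⊎-dec (x Fin.≟ z)

degree : Vec (Line b) k → Fin b → ℕ
degree ls x = count (borders? x) ls

-- During play the index set Fin b of boxes stays fixed and only the undrawn
-- lines are recorded: the boxes not yet claimed are those that still have
-- an undrawn line.

Unclaimed : Vec (Line b) k → Fin b → Set
Unclaimed ls x = Any (Borders x) ls

unclaimed? : (ls : Vec (Line b) k) → Decidable (Unclaimed ls)
unclaimed? ls x = any? (borders? x) ls

record Game : Set where
  field
    boxes     : ℕ
    size      : ℕ
    lines     : Vec (Line boxes) size
    unclaimed : ∀ x → Unclaimed lines x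
    degree≤4  : ∀ x → degree lines x ≤ 4

open Game public

------------------------------------------------------------------------
-- Value

claims : Vec (Line b) (suc k) → Fin (suc k) → ℕ
claims {b} ls i =
  count (λ x → unclaimed? ls x ×-dec ¬? (unclaimed? (removeAt ls i) x)) (allFin b)

-- Values are net scores of the player not to move, so the sign changes
-- exactly when the turn passes, i.e. when no box is claimed.

afterMove : ℕ → ℤ → ℤ
afterMove zero      w = - w
afterMove k@(suc _) w = w -ℤ + k

value : Vec (Line b) k → ℤ
value {k = zero}  _  = 0ℤ
value {k = suc k} ls =
  foldr₁ _⊓_ (tabulate λ i → afterMove (claims ls i) (value (removeAt ls i)))

v : Game → ℤ
v G = value (lines G)

------------------------------------------------------------------------
-- Disjoint union

relabel : (f : Fin m → Fin n) → (∀ {x y} → f x ≡ f y → x ≡ y) → Line m → Line n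
relabel f f-inj (outer x)       = outer (f x)
relabel f f-inj (inner x y x≢y) = inner (f x) (f y) (λ eq → x≢y (f-inj eq))

left : ∀ m n → Line m → Line (m + n)
left m n = relabel (_↑ˡ n) (Fin.↑ˡ-injective n _ _)

right : ∀ m n → Line n → Line (m + n)
right m n = relabel (m ↑ʳ_) (Fin.↑ʳ-injective m _ _)

private
  module _ {f : Fin m → Fin n} (f-inj : ∀ {x y} → f x ≡ f y → x ≡ y) where

    borders-relabel : ∀ {x} l → Borders (f x) (relabel f f-inj l) ⇔ Borders x l
    borders-relabel (outer _)     = mk⇔ f-inj (cong f)
    borders-relabel (inner _ _ _) =
      mk⇔ (Sum.map f-inj f-inj) (Sum.map (cong f) (cong f))

    degree-relabel : ∀ x (ls : Vec (Line m) k) →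
                     degree (Vec.map (relabel f f-inj) ls) (f x) ≡ degree ls x
    degree-relabel x []       = refl
    degree-relabel x (l ∷ ls)
      rewrite does-⇔ (borders-relabel l) (borders? (f x) (relabel f f-inj l)) (borders? x l)
      with does (borders? x l)
    ... | true  = cong suc (degree-relabel x ls)
    ... | false = degree-relabel x ls

    unclaimed-relabel : ∀ {x} {ls : Vec (Line m) k} → Unclaimed ls x →
                        Unclaimed (Vec.map (relabel f f-inj) ls) (f x)
    unclaimed-relabel (here {x = l} p) = here (Equivalence.from (borders-relabel l) p)
    unclaimed-relabel (there p)        = there (unclaimed-relabel p)

    degree-relabel-∉ : ∀ {z} → (∀ x → z ≢ f x) → (ls : Vec (Line m) k) →
                       degree (Vec.map (relabel f f-inj) ls) z ≡ 0
    degree-relabel-∉ z∉ []             = refl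
    degree-relabel-∉ {z = z} z∉ (outer x ∷ ls) with z Fin.≟ f x
    ... | yes eq = ⊥-elim (z∉ x eq)
    ... | no  _  = degree-relabel-∉ z∉ ls
    degree-relabel-∉ {z = z} z∉ (inner x y _ ∷ ls) with z Fin.≟ f x | z Fin.≟ f y
    ... | yes eq | _      = ⊥-elim (z∉ x eq)
    ... | no  _  | yes eq = ⊥-elim (z∉ y eq)
    ... | no  _  | no  _  = degree-relabel-∉ z∉ ls

  degree-++ : ∀ (ls : Vec (Line b) m) (ms : Vec (Line b) n) x →
              degree (ls ++ ms) x ≡ degree ls x + degree ms x
  degree-++ []       ms x = refl
  degree-++ (l ∷ ls) ms x with does (borders? x l)
  ... | true  = cong suc (degree-++ ls ms x)
  ... | false = degree-++ ls ms x

  ↑ˡ≢↑ʳ : ∀ {m n} (i : Fin m) (j : Fin n) → i ↑ˡ n ≢ m ↑ʳ j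
  ↑ˡ≢↑ʳ {m} {n} i j eq
    with () ← trans (sym (Fin.splitAt-↑ˡ m i n))
                    (trans (cong (splitAt m) eq) (Fin.splitAt-↑ʳ m n j))

infixr 6 _⊕_

_⊕_ : Game → Game → Game
G ⊕ H = record
  { boxes     = g + h
  ; size      = size G + size H
  ; lines     = ls ++ ms
  ; unclaimed = λ x → subst (Unclaimed (ls ++ ms)) (Fin.join-splitAt g h x) (un (splitAt g x))
  ; degree≤4  = λ x → subst (λ x → degree (ls ++ ms) x ≤ 4) (Fin.join-splitAt g h x) (deg (splitAt g x))
  }
  where
  g  = boxes G
  h  = boxes H
  ls = Vec.map (left g h) (lines G)
  ms = Vec.map (right g h) (lines H)

  un : ∀ s → Unclaimed (ls ++ ms) (join g h s)
  un (inj₁ x) = Any.++⁺ˡ (unclaimed-relabel _ (unclaimed G x))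
  un (inj₂ y) = Any.++⁺ʳ ls (unclaimed-relabel _ (unclaimed H y))

  deg : ∀ s → degree (ls ++ ms) (join g h s) ≤ 4
  deg (inj₁ x)
    rewrite degree-++ ls ms (x ↑ˡ h)
          | degree-relabel {f = _↑ˡ h} (Fin.↑ˡ-injective h _ _) x (lines G)
          | degree-relabel-∉ {f = g ↑ʳ_} (Fin.↑ʳ-injective g _ _) (↑ˡ≢↑ʳ x) (lines H)
          | ℕ.+-identityʳ (degree (lines G) x)
    = degree≤4 G x
  deg (inj₂ y)
    rewrite degree-++ ls ms (g ↑ʳ y)
          | degree-relabel {f = g ↑ʳ_} (Fin.↑ʳ-injective g _ _) y (lines H)
          | degree-relabel-∉ {f = _↑ˡ h} (Fin.↑ˡ-injective h _ _) (λ x eq → ↑ˡ≢↑ʳ x y (sym eq)) (lines G)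
    = degree≤4 H y

∅ : Game
∅ = record
  { boxes = 0 ; size = 0 ; lines = [] ; unclaimed = λ () ; degree≤4 = λ () }

⨁ : List Game → Game
⨁ = List.foldr _⊕_ ∅

------------------------------------------------------------------------
-- Chains and loops

private
  inject₁≢suc : (i : Fin n) → inject₁ i ≢ suc i
  inject₁≢suc (suc i) eq = inject₁≢suc i (Fin.suc-injective eq)

-- The lines separating consecutive boxes of a row of n + 1 boxes.

path : ∀ n → Vec (Line (suc n)) n
path n = tabulate λ i → inner (inject₁ i) (suc i) (inject₁≢suc i)

chainLines : ∀ n → Vec (Line (suc n)) (2 + n)
chainLines n = outer zero ∷ outer (fromℕ n) ∷ path n

loopLines : ∀ n → Vec (Line (2 + n)) (2 + n)
loopLines n = inner (fromℕ (suc n)) zero (λ ()) ∷ path (suc n)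

private
  degree-∷ : ∀ (l : Line b) (ls : Vec (Line b) k) x → degree (l ∷ ls) x ≤ suc (degree ls x)
  degree-∷ l ls x with does (borders? x l)
  ... | true  = ℕ.≤-refl
  ... | false = ℕ.n≤1+n _

  degree-shift-suc : ∀ (f g : Fin k → Fin b) .(f≢g : ∀ i → f i ≢ g i) .(f≢g′ : ∀ i → suc (f i) ≢ suc (g i)) x →
    degree (tabulate λ i → inner (suc (f i)) (suc (g i)) (f≢g′ i)) (suc x) ≡
    degree (tabulate λ i → inner (f i) (g i) (f≢g i)) x
  degree-shift-suc {k = zero}  f g p q x = refl
  degree-shift-suc {k = suc _} f g p q x
    with does (x Fin.≟ f zero) ∨ does (x Fin.≟ g zero)
  ... | true  = cong suc (degree-shift-suc (f ∘ suc) (g ∘ suc) (λ i → p (suc i)) (λ i → q (suc i)) x)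
  ... | false = degree-shift-suc (f ∘ suc) (g ∘ suc) (λ i → p (suc i)) (λ i → q (suc i)) x

  degree-shift-zero : ∀ (f g : Fin k → Fin b) .(p : ∀ i → suc (f i) ≢ suc (g i)) →
    degree (tabulate λ i → inner (suc (f i)) (suc (g i)) (p i)) zero ≡ 0
  degree-shift-zero {k = zero}  f g p = refl
  degree-shift-zero {k = suc _} f g p = degree-shift-zero (f ∘ suc) (g ∘ suc) (λ i → p (suc i))

  degree-path-zero : ∀ n → degree (path n) zero ≤ 1
  degree-path-zero zero    = z≤n
  degree-path-zero (suc n) = s≤s (ℕ.≤-reflexive (degree-shift-zero {k = n} inject₁ suc (λ i → inject₁≢suc (suc i))))

  degree-path : ∀ n x → degree (path n) x ≤ 2
  degree-path zero    x              = z≤n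
  degree-path (suc n) zero           = ℕ.≤-trans (degree-path-zero (suc n)) (s≤s z≤n)
  degree-path (suc n) (suc zero)     =
    s≤s (ℕ.≤-trans (ℕ.≤-reflexive (degree-shift-suc {k = n} inject₁ suc inject₁≢suc (λ i → inject₁≢suc (suc i)) zero))
                   (degree-path-zero n))
  degree-path (suc n) (suc (suc x)) =
    ℕ.≤-trans (ℕ.≤-reflexive (degree-shift-suc {k = n} inject₁ suc inject₁≢suc (λ i → inject₁≢suc (suc i)) (suc x)))
              (degree-path n (suc x))

  unclaimed-path : ∀ n x → Unclaimed (path (suc n)) x
  unclaimed-path n zero    = here (inj₁ refl)
  unclaimed-path n (suc x) =
    Any.tabulate⁺ {f = λ i → inner (inject₁ i) (suc i) (inject₁≢suc i)} x (inj₂ refl)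

chain : ∀ n → .{{NonZero n}} → Game
chain (suc n) = record
  { boxes     = suc n
  ; size      = 2 + n
  ; lines     = chainLines n
  ; unclaimed = un n
  ; degree≤4  = λ x → ℕ.≤-trans (degree-∷ (outer zero) (outer (fromℕ n) ∷ path n) x)
                 (s≤s (ℕ.≤-trans (degree-∷ (outer (fromℕ n)) (path n) x)
                   (s≤s (degree-path n x))))
  }
  where
  un : ∀ n x → Unclaimed (chainLines n) x
  un n       zero    = here refl
  un (suc n) (suc x) = there (there (unclaimed-path n (suc x)))

loop : ∀ n → 4 ≤ n → Game
loop 1 (s≤s ())
loop (suc (suc n)) _ = record
  { boxes     = 2 + n
  ; size      = 2 + n
  ; lines     = loopLines n
  ; unclaimed = λ x → there (unclaimed-path n x)
  ; degree≤4  = λ x → ℕ.≤-trans (degree-∷ (inner (fromℕ (suc n)) zero (λ ())) (path (suc n)) x)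
                 (s≤s (ℕ.≤-trans (degree-path (suc n) x) (s≤s (s≤s z≤n))))
  }

------------------------------------------------------------------------
-- Simple loony endgames

record Chain : Set where
  constructor mkChain
  field
    length   : ℕ
    3≤length : 3 ≤ length

record Loop : Set where
  constructor mkLoop
  field
    length   : ℕ
    4≤length : 4 ≤ length
    even     : 2 ∣ length

record SimpleLoonyEndgame : Set where
  constructor endgame
  field
    chains : List Chain
    loops  : List Loop

open SimpleLoonyEndgame public

chainGame : Chain → Game
chainGame (mkChain n 3≤n) = chain n {{>-nonZero (ℕ.≤-trans (s≤s z≤n) 3≤n)}}

loopGame : Loop → Game
loopGame (mkLoop n 4≤n _) = loop n 4≤n

⟦_⟧ : SimpleLoonyEndgame → Game
⟦ E ⟧ = ⨁ (List.map chainGame (chains E) List.++ List.map loopGame (loops E))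

three+_ : SimpleLoonyEndgame → SimpleLoonyEndgame
three+ H = record H { chains = mkChain 3 ℕ.≤-refl ∷ chains H }

fourLoop? : (ℓ : Loop) → Dec (Loop.length ℓ ≡ 4)
fourLoop? ℓ = Loop.length ℓ ℕ.≟ 4

#fourLoops : SimpleLoonyEndgame → ℕ
#fourLoops E = List.length (List.filter fourLoop? (loops E))

withoutFourLoops : SimpleLoonyEndgame → SimpleLoonyEndgame
withoutFourLoops E = record E { loops = List.filter (¬? ∘ fourLoop?) (loops E) }

------------------------------------------------------------------------
-- Controlled value

sumℤ : List ℤ → ℤ
sumℤ = List.foldr _+ℤ_ 0ℤ

fcv : SimpleLoonyEndgame → ℤ
fcv E = sumℤ (List.map (λ c → + Chain.length c -ℤ + 4) (chains E))
     +ℤ sumℤ (List.map (λ ℓ → + Loop.length ℓ -ℤ + 8) (loops E))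

tb : SimpleLoonyEndgame → ℤ
tb (endgame []         [])      = + 0
tb (endgame []         (_ ∷ _)) = + 8
tb (endgame (_ ∷ _)    [])      = + 4
tb (endgame cs@(_ ∷ _) (_ ∷ _)) =
  if does (ListAny.any? (λ c → 4 ℕ.≤? Chain.length c) cs) then + 4 else + 6

cv : SimpleLoonyEndgame → ℤ
cv E = fcv E +ℤ tb E

-- Only four kinds of component occur when chains and loops are played: the
-- chains and loops themselves, and the strings left by opening them, with one
-- outer line (from a chain) or none (from a loop).  If E without capturable
-- boxes has value x, then capturing everything gains |S| - x from a position
-- S + E with strings S.  The alternative is to give up the last 2 boxes of a
-- string with an outer line, or the last 4 of one without, to keep control.
-- Hence opening a chain of n boxes yields n - 2 + |x - 2| and opening a loop
-- n - 4 + |x - 4|, and v is the minimum of these over all components.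
--
-- For loops of even length the corollary is then arithmetic.  The controlled
-- value is a lower bound, attained if at least 2.  If it is at most 1 and
-- v(H) ≠ 2, then v(G) is 1 or 3, and 1 only by opening a 4-loop.  Without
-- 4-loops the 3-chain or a 6-loop gives 3; otherwise all 4-loops are equally
-- good by induction, so v(G) = |v(G') - 4| where G' = 3 + H' is G without one
-- of them.  The induction applies because v(H') = 2 would give v(H) = 2: the
-- numbers v(H)/2 and v(H')/2 have the same parity, and v(H) ≤ |v(H') - 4|.

module Submission where

open import Defs hiding (left; right)
import Algebra.Properties.AbelianGroup
open import Data.Bool.Base using (Bool; true; false)
open import Data.Fin.Base using (Fin; zero; suc; inject₁; fromℕ; _↑ˡ_; _↑ʳ_)
import Data.Fin.Properties as Fin
open import Data.Integer.Base as ℤ using (ℤ; +_; -[1+_]; -_; _-_; _≤_; ∣_∣; _%ℕ_; _⊓_; 0ℤ)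
import Data.Integer.Properties as ℤ
import Data.Integer.Tactic.RingSolver as ℤRing
open import Data.List.Base as List using (List; []; _∷_; _++_; length; mapMaybe; concatMap; filter)
import Data.List.Properties as List
open import Data.List.Membership.Propositional using (_∈_)
open import Data.List.Membership.Propositional.Properties using (∈-∃++; ∈-map⁻; ∈-++⁻; ∈-++⁺ˡ; ∈-++⁺ʳ)
open import Data.List.Relation.Binary.Permutation.Propositional hiding (trans)
open import Data.List.Relation.Binary.Permutation.Propositional.Properties hiding (sum-↭)
import Data.List.Relation.Binary.Permutation.Setoid.Properties as PermSetoid
open import Data.List.Relation.Unary.All as All using (All; []; _∷_)
open import Data.List.Relation.Unary.AllPairs using ([]; _∷_)
open import Data.List.Relation.Unary.Any as ListAny using (here; there)
import Data.List.Relation.Unary.Any.Properties as ListAny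
import Data.List.Relation.Unary.Unique.Propositional.Properties as Unique
open import Data.Maybe.Base using (Maybe; just; nothing)
open import Data.Maybe.Properties using (just-injective)
open import Data.Nat.Base as ℕ using (ℕ; zero; suc; _+_; _*_; _∸_; _<_; z≤n; s≤s) renaming (_≤_ to _≤ℕ_)
open import Data.Nat.DivMod using (_%_; [m+n]%n≡m%n)
open import Data.Nat.Divisibility using (_∣_; divides; ∣m+n∣m⇒∣n; ∣m∣n⇒∣m+n; m∣m*n; ∣-refl; _∣0; ∣1⇒≡1)
open import Data.Nat.ListAction using (sum)
open import Data.Nat.ListAction.Properties using (sum-↭)
open import Data.Nat.Properties
open import Data.Nat.Tactic.RingSolver using (solve-∀)
open import Data.Product.Base as Product using (_×_; _,_; ∃; ∃-syntax; proj₁; proj₂)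
open import Data.Sum.Base using (_⊎_; inj₁; inj₂)
open import Data.Vec.Base as Vec using (Vec; []; _∷_; lookup; removeAt; toList; fromList; foldr₁; tabulate)
import Data.Vec.Properties as Vec
open import Data.Vec.Relation.Unary.Any using (here; there)
open import Function.Base using (_∘_; id)
open import Relation.Binary.PropositionalEquality
open import Relation.Nullary using (¬_; ¬?; does; yes; no; contradiction)
open import Relation.Nullary.Decidable using (_×-dec_)
open import Relation.Unary using (Decidable)

module ℤGroup = Algebra.Properties.AbelianGroup ℤ.+-0-abelianGroup

private
  variable
    X Y : Set
    b k m n : ℕ

-- Shapes of the components of a position and their realizations

-- A n and B n are strings of n + 1 and n + 2 boxes with one and no outer
-- line, C n is a chain of n + 1 boxes and O n is a loop of n + 2 boxes.
data Shape : Set where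
  A B C O : ℕ → Shape

infix 4 _⟶⟨_⟩_

-- s ⟶⟨ k ⟩ ss: a move in s claims k boxes and leaves ss.
data _⟶⟨_⟩_ : Shape → ℕ → List Shape → Set where
  C-end  :       C n             ⟶⟨ 0 ⟩ A n ∷ []
  C-mid  : ∀ m → C (suc (m + n)) ⟶⟨ 0 ⟩ A m ∷ A n ∷ []
  A-last :       A 0             ⟶⟨ 1 ⟩ []
  A-take :       A (suc n)       ⟶⟨ 1 ⟩ A n ∷ []
  A-far  :       A (suc n)       ⟶⟨ 0 ⟩ B n ∷ []
  A-mid  : ∀ m → A (2 + (m + n)) ⟶⟨ 0 ⟩ B m ∷ A n ∷ []
  B-last :       B 0             ⟶⟨ 2 ⟩ []
  B-take :       B (suc n)       ⟶⟨ 1 ⟩ B n ∷ []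
  B-mid  : ∀ m → B (2 + (m + n)) ⟶⟨ 0 ⟩ B m ∷ B n ∷ []
  O-cut  :       O n             ⟶⟨ 0 ⟩ B n ∷ []

-- An outer line at `x` becomes the pair `(x , x)`, so both kinds of line are ordered pairs of
-- boxes.
Edge : ℕ → Set
Edge b = Fin b × Fin b

-- In  row l x xs r  the flags record whether the outer lines at the two
-- ends of the row x ∷ xs are still undrawn.
data Piece (b : ℕ) : Set where
  row : Bool → Fin b → List (Fin b) → Bool → Piece b
  cyc : Fin b → List (Fin b) → Piece b

boxesOf : Piece b → List (Fin b)
boxesOf (row _ x xs _) = x ∷ xs
boxesOf (cyc x xs)     = x ∷ xs

lastOf : X → List X → X
lastOf x []       = x
lastOf x (y ∷ ys) = lastOf y ys

links : X → List X → List (X × X)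
links x []       = []
links x (y ∷ ys) = (x , y) ∷ links y ys

end : Bool → Fin b → List (Edge b)
end true  x = (x , x) ∷ []
end false x = []

edgesOf : Piece b → List (Edge b)
edgesOf (row l x xs r) = end l x ++ end r (lastOf x xs) ++ links x xs
edgesOf (cyc x xs)     = (lastOf x xs , x) ∷ links x xs

-- A row of one box without lines is a claimed box and has no shape; a cycle
-- of one box has a single line and so plays like a string.
shape : Piece b → Maybe Shape
shape (row true  x xs       true)  = just (C (length xs))
shape (row true  x xs       false) = just (A (length xs))
shape (row false x xs       true)  = just (A (length xs))
shape (row false x []       false) = nothing
shape (row false x (y ∷ ys) false) = just (B (length ys))
shape (cyc x [])                   = just (A 0)
shape (cyc x (y ∷ ys))             = just (O (length ys))

shapes : List (Piece b) → List Shape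
shapes = mapMaybe shape

claimed : Piece b → ℕ
claimed p with shape p
... | just _  = 0
... | nothing = 1

-- Removing one edge from a piece

data Cut {b} : Piece b → Edge b → List (Piece b) → Set where
  cutˡ  : ∀ x xs r → Cut (row true x xs r) (x , x) (row false x xs r ∷ [])
  cutʳ : ∀ l x xs → Cut (row l x xs true) (lastOf x xs , lastOf x xs) (row l x xs false ∷ [])
  cutᵐ   : ∀ l x ys z zs r → Cut (row l x (ys ++ z ∷ zs) r) (lastOf x ys , z)
                                (row l x ys false ∷ row false z zs r ∷ [])
  closeᶜ : ∀ x xs → Cut (cyc x xs) (lastOf x xs , x) (row false x xs false ∷ [])
  -- The remaining row starts behind the removed edge and runs once round the cycle.
  openᶜ : ∀ x ys z zs → Cut (cyc x (ys ++ z ∷ zs)) (lastOf x ys , z)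
                            (row false z (zs ++ x ∷ ys) false ∷ [])

lastOf-++ : ∀ (x : X) ys z zs → lastOf x (ys ++ z ∷ zs) ≡ lastOf z zs
lastOf-++ x []       z zs = refl
lastOf-++ x (y ∷ ys) z zs = lastOf-++ y ys z zs

links-++ : ∀ (x : X) ys z zs → links x (ys ++ z ∷ zs) ≡ links x ys ++ (lastOf x ys , z) ∷ links z zs
links-++ x []       z zs = refl
links-++ x (y ∷ ys) z zs = cong (_ ∷_) (links-++ y ys z zs)

∈-links⁻ : ∀ (x : X) xs {e} → e ∈ links x xs →
           ∃[ ys ] ∃[ z ] ∃[ zs ] xs ≡ ys ++ z ∷ zs × e ≡ (lastOf x ys , z)
∈-links⁻ x (y ∷ ys) (here refl) = [] , y , ys , refl , refl
∈-links⁻ x (y ∷ ys) (there e∈) with _ , _ , _ , refl , refl ← ∈-links⁻ y ys e∈ =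
  y ∷ _ , _ , _ , refl , refl

cut-boxes : ∀ {p : Piece b} {e ps} → Cut p e ps → boxesOf p ↭ concatMap boxesOf ps
cut-boxes (cutˡ x xs r)       = ↭-reflexive (sym (List.++-identityʳ _))
cut-boxes (cutʳ l x xs)      = ↭-reflexive (sym (List.++-identityʳ _))
cut-boxes (cutᵐ l x ys z zs r) = ↭-reflexive (cong (λ ws → x ∷ ys ++ z ∷ ws) (sym (List.++-identityʳ zs)))
cut-boxes (closeᶜ x xs)        = ↭-reflexive (sym (List.++-identityʳ _))
cut-boxes (openᶜ x ys z zs)   = ↭-trans (++-comm (x ∷ ys) (z ∷ zs)) (↭-reflexive (sym (List.++-identityʳ _)))

cut-edges : ∀ {p : Piece b} {e ps} → Cut p e ps → edgesOf p ↭ e ∷ concatMap edgesOf ps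
cut-edges (cutˡ x xs r)       = prep _ (↭-reflexive (sym (List.++-identityʳ _)))
cut-edges (cutʳ l x xs)      = ↭-trans (shift _ (end l x) _) (prep _ (↭-reflexive (sym (List.++-identityʳ _))))
cut-edges (cutᵐ l x ys z zs r)
  rewrite lastOf-++ x ys z zs | links-++ x ys z zs
        | List.++-identityʳ (end r (lastOf z zs) ++ links z zs)
        | List.++-assoc (end l x) (links x ys) (end r (lastOf z zs) ++ links z zs)
  = ↭-trans (++⁺ˡ (end l x) (shifts (end r (lastOf z zs)) (links x ys)))
      (↭-trans (++⁺ˡ (end l x) (++⁺ˡ (links x ys) (shift _ (end r _) _)))
        (↭-trans (++⁺ˡ (end l x) (shift _ (links x ys) _)) (shift _ (end l x) _)))
cut-edges (closeᶜ x xs)        = prep _ (↭-reflexive (sym (List.++-identityʳ _)))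
cut-edges (openᶜ x ys z zs)
  rewrite lastOf-++ x ys z zs | links-++ x ys z zs | links-++ z zs x ys
        | List.++-identityʳ (links z zs ++ (lastOf z zs , x) ∷ links x ys)
  = ↭-trans (prep _ (shift _ (links x ys) _))
      (↭-trans (swap _ _ (++-comm (links x ys) (links z zs)))
        (prep _ (↭-sym (shift _ (links z zs) _))))

∈-end⁻ : ∀ l {x : Fin b} {e} → e ∈ end l x → l ≡ true × e ≡ (x , x)
∈-end⁻ true (here refl) = refl , refl

edge-cut : ∀ (p : Piece b) {e} → e ∈ edgesOf p → ∃ (Cut p e)
edge-cut (row l x xs r) e∈ with ∈-++⁻ (end l x) e∈
... | inj₁ e∈ˡ with refl , refl ← ∈-end⁻ l e∈ˡ = _ , cutˡ x xs r
... | inj₂ e∈′ with ∈-++⁻ (end r (lastOf x xs)) e∈′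
...   | inj₁ e∈ʳ with refl , refl ← ∈-end⁻ r e∈ʳ = _ , cutʳ l x xs
...   | inj₂ e∈ᵐ with _ , _ , _ , refl , refl ← ∈-links⁻ x xs e∈ᵐ = _ , cutᵐ l x _ _ _ r
edge-cut (cyc x xs) (here refl) = _ , closeᶜ x xs
edge-cut (cyc x xs) (there e∈) with _ , _ , _ , refl , refl ← ∈-links⁻ x xs e∈ = _ , openᶜ x _ _ _

dead : List (Piece b) → ℕ
dead = sum ∘ List.map claimed

length-++-∷ : ∀ (ys : List X) {z} zs → length (ys ++ z ∷ zs) ≡ suc (length ys + length zs)
length-++-∷ ys zs = trans (List.length-++ ys) (+-suc (length ys) (length zs))

-- Soundness of the moves on shapes: a piece with an edge has a shape, and the pieces of `ps`
-- without a shape are the boxes that the move claims.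
cut-step : ∀ {p : Piece b} {e ps} → Cut p e ps →
           ∃[ s ] ∃[ ss ] shape p ≡ just s × s ⟶⟨ dead ps ⟩ ss × shapes ps ↭ ss
cut-step (cutˡ x xs       true)  = _ , _ , refl , C-end , refl
cut-step (cutˡ x []       false) = _ , _ , refl , A-last , refl
cut-step (cutˡ x (y ∷ ys) false) = _ , _ , refl , A-far , refl
cut-step (cutʳ true  x xs)       = _ , _ , refl , C-end , refl
cut-step (cutʳ false x [])       = _ , _ , refl , A-last , refl
cut-step (cutʳ false x (y ∷ ys)) = _ , _ , refl , A-far , refl
cut-step (cutᵐ true x ys z zs true) rewrite length-++-∷ ys {z} zs =
  _ , _ , refl , C-mid (length ys) , refl
-- A string with its outer line on the left is eaten from the right, so here `z` is the claimed box.
cut-step (cutᵐ true x ys z [] false) rewrite length-++-∷ ys {z} [] | +-identityʳ (length ys) =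
  _ , _ , refl , A-take , refl
cut-step (cutᵐ true x ys z (w ∷ ws) false) rewrite length-++-∷ ys {z} (w ∷ ws)
  | +-suc (length ys) (length ws) | +-comm (length ys) (length ws) =
  _ , _ , refl , A-mid (length ws) , swap _ _ refl
cut-step (cutᵐ false x [] z zs true) = _ , _ , refl , A-take , refl
cut-step (cutᵐ false x (y ∷ ys) z zs true) rewrite length-++-∷ ys {z} zs =
  _ , _ , refl , A-mid (length ys) , refl
cut-step (cutᵐ false x [] z [] false) = _ , _ , refl , B-last , refl
cut-step (cutᵐ false x [] z (w ∷ ws) false) = _ , _ , refl , B-take , refl
cut-step (cutᵐ false x (y ∷ ys) z [] false) rewrite length-++-∷ ys {z} [] | +-identityʳ (length ys) =
  _ , _ , refl , B-take , refl
cut-step (cutᵐ false x (y ∷ ys) z (w ∷ ws) false) rewrite length-++-∷ ys {z} (w ∷ ws)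
  | +-suc (length ys) (length ws) =
  _ , _ , refl , B-mid (length ys) , refl
cut-step (closeᶜ x [])       = _ , _ , refl , A-last , refl
cut-step (closeᶜ x (y ∷ ys)) = _ , _ , refl , O-cut , refl
cut-step (openᶜ x [] z []) = _ , _ , refl , O-cut , refl
cut-step (openᶜ x [] z (w ∷ ws)) rewrite length-++-∷ ws {x} [] | +-identityʳ (length ws) =
  _ , _ , refl , O-cut , refl
cut-step (openᶜ x (y ∷ ys) z []) rewrite length-++-∷ ys {z} [] | +-identityʳ (length ys) =
  _ , _ , refl , O-cut , refl
cut-step (openᶜ x (y ∷ ys) z (w ∷ ws)) rewrite length-++-∷ ys {z} (w ∷ ws) | length-++-∷ ws {x} (y ∷ ys)
  | +-suc (length ys) (length ws) | +-suc (length ws) (length ys) | +-comm (length ys) (length ws) =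
  _ , _ , refl , O-cut , refl

split : ∀ m {n} (xs : List X) → length xs ≡ suc (m + n) →
        ∃[ ys ] ∃[ z ] ∃[ zs ] xs ≡ ys ++ z ∷ zs × length ys ≡ m × length zs ≡ n
split zero    (x ∷ xs) refl = [] , x , xs , refl , refl , refl
split (suc m) (x ∷ xs) eq with ys , z , zs , refl , refl , refl ← split m xs (suc-injective eq) =
  x ∷ ys , z , zs , refl , refl , refl

Realized : Piece b → ℕ → List Shape → Set
Realized p k ss = ∃[ e ] ∃[ ps ] Cut p e ps × dead ps ≡ k × shapes ps ↭ ss


A-injective : A m ≡ A n → m ≡ n
A-injective refl = refl

B-injective : B m ≡ B n → m ≡ n
B-injective refl = refl

C-injective : C m ≡ C n → m ≡ n
C-injective refl = refl

-- Completeness of the moves on shapes: one witness per move suffices. The position of the outer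
-- line fixes the side from which a string is cut; for a cycle the closing edge serves.
step-cut : ∀ {s ss} (p : Piece b) → s ⟶⟨ k ⟩ ss → shape p ≡ just s → Realized p k ss
step-cut (row true x xs true) C-end refl = _ , _ , cutˡ x xs true , refl , refl
step-cut (row true x xs true) (C-mid {n} m) eq
  with ys , z , zs , refl , refl , refl ← split m {n} xs (C-injective (just-injective eq))
  = _ , _ , cutᵐ true x ys z zs true , refl , refl
step-cut (row true x [] false) A-last eq = _ , _ , cutˡ x [] false , refl , refl
step-cut (row true x xs false) (A-take {n}) eq
  with ys , z , [] , refl , refl , refl ← split n {0} xs
         (trans (A-injective (just-injective eq)) (cong suc (sym (+-identityʳ n))))
  = _ , _ , cutᵐ true x ys z [] false , refl , refl
step-cut (row true x (y ∷ ys) false) A-far refl = _ , _ , cutˡ x (y ∷ ys) false , refl , refl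
step-cut (row true x xs false) (A-mid {n} m) eq
  with ys , z , w ∷ ws , refl , refl , refl ← split n {suc m} xs
         (trans (A-injective (just-injective eq))
                (cong suc (trans (cong suc (+-comm m n)) (sym (+-suc n m)))))
  = _ , _ , cutᵐ true x ys z (w ∷ ws) false , refl , swap _ _ refl
step-cut (row false x [] true) A-last eq = _ , _ , cutʳ false x [] , refl , refl
step-cut (row false x (y ∷ ys) true) A-take refl = _ , _ , cutᵐ false x [] y ys true , refl , refl
step-cut (row false x (y ∷ ys) true) A-far refl = _ , _ , cutʳ false x (y ∷ ys) , refl , refl
step-cut (row false x xs true) (A-mid {n} m) eq
  with y ∷ ys , z , zs , refl , refl , refl ← split (suc m) {n} xs (A-injective (just-injective eq))
  = _ , _ , cutᵐ false x (y ∷ ys) z zs true , refl , refl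
step-cut (row false x (y ∷ []) false) B-last eq = _ , _ , cutᵐ false x [] y [] false , refl , refl
step-cut (row false x (y ∷ w ∷ ws) false) B-take refl = _ , _ , cutᵐ false x [] y (w ∷ ws) false , refl , refl
step-cut (row false x (y ∷ ys) false) (B-mid {n} m) eq
  with y ∷ ys , z , w ∷ ws , refl , refl , refl ← split (suc m) {suc n} (y ∷ ys)
         (cong suc (trans (B-injective (just-injective eq)) (cong suc (sym (+-suc m n)))))
  = _ , _ , cutᵐ false x (y ∷ ys) z (w ∷ ws) false , refl , refl
step-cut (cyc x []) A-last eq = _ , _ , closeᶜ x [] , refl , refl
step-cut (cyc x (y ∷ ys)) O-cut refl = _ , _ , closeᶜ x (y ∷ ys) , refl , refl

concatMap-↭ : (f : X → List Y) → ∀ {xs ys} → xs ↭ ys → concatMap f xs ↭ concatMap f ys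
concatMap-↭ f refl         = refl
concatMap-↭ f (prep x p)   = ++⁺ˡ (f x) (concatMap-↭ f p)
concatMap-↭ f (swap x y p) =
  ↭-trans (shifts (f x) (f y)) (++⁺ˡ (f y) (++⁺ˡ (f x) (concatMap-↭ f p)))
concatMap-↭ f (_↭_.trans p q) = ↭-trans (concatMap-↭ f p) (concatMap-↭ f q)

∈-extract : ∀ {x : X} {xs} → x ∈ xs → ∃[ ys ] xs ↭ x ∷ ys
∈-extract x∈ with ys , zs , refl ← ∈-∃++ x∈ = ys ++ zs , shift _ ys zs

removeAt-↭ : ∀ (xs : Vec X (suc n)) i → toList xs ↭ lookup xs i ∷ toList (removeAt xs i)
removeAt-↭ (x ∷ xs)         zero    = refl
removeAt-↭ (x ∷ xs@(_ ∷ _)) (suc i) = ↭-trans (prep x (removeAt-↭ xs i)) (swap x _ refl)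

∈-toList⁻ : ∀ {x : X} (xs : Vec X n) → x ∈ toList xs → ∃[ i ] x ≡ lookup xs i
∈-toList⁻ (x ∷ xs) (here eq) = zero , eq
∈-toList⁻ (x ∷ xs) (there x∈) with i , eq ← ∈-toList⁻ xs x∈ = suc i , eq

-- Positions with given shapes

infix 4 _∈ᵉ_

_∈ᵉ_ : Fin b → Edge b → Set
x ∈ᵉ (y , z) = x ≡ y ⊎ x ≡ z

Touched : Fin b → List (Edge b) → Set
Touched x = ListAny.Any (x ∈ᵉ_)

edge : Line b → Edge b
edge (outer x)     = x , x
edge (inner x y _) = x , y

edges : Vec (Line b) k → List (Edge b)
edges ls = List.map edge (toList ls)

touched⁺ : ∀ {x} (ls : Vec (Line b) k) → Unclaimed ls x → Touched x (edges ls)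
touched⁺ (outer _ ∷ ls)     (here p)  = here (inj₁ p)
touched⁺ (inner _ _ _ ∷ ls) (here p)  = here p
touched⁺ (_ ∷ ls)           (there p) = there (touched⁺ ls p)

touched⁻ : ∀ {x} (ls : Vec (Line b) k) → Touched x (edges ls) → Unclaimed ls x
touched⁻ (outer _ ∷ ls)     (here (inj₁ p)) = here p
touched⁻ (outer _ ∷ ls)     (here (inj₂ p)) = here p
touched⁻ (inner _ _ _ ∷ ls) (here p)        = here p
touched⁻ (_ ∷ ls)           (there p)       = there (touched⁻ ls p)

links-touch : ∀ (x : Fin b) y ys → All (λ z → Touched z (links x (y ∷ ys))) (x ∷ y ∷ ys)
links-touch x y []       = here (inj₁ refl) ∷ here (inj₂ refl) ∷ []
links-touch x y (w ∷ ws) = here (inj₁ refl) ∷ All.map there (links-touch y w ws)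

-- A single box with a shape keeps an edge of its own, and in longer pieces the links reach every
-- box.
live-touched : ∀ (p : Piece b) {s} → shape p ≡ just s → All (λ z → Touched z (edgesOf p)) (boxesOf p)
live-touched (row true  x [] r)           _ = here (inj₁ refl) ∷ []
live-touched (row false x [] true)        _ = here (inj₁ refl) ∷ []
live-touched (row l     x (y ∷ ys) r)     _ =
  All.map (ListAny.++⁺ʳ (end l x) ∘ ListAny.++⁺ʳ (end r (lastOf y ys))) (links-touch x y ys)
live-touched (cyc x [])                   _ = here (inj₁ refl) ∷ []
live-touched (cyc x (y ∷ ys))             _ = All.map there (links-touch x y ys)

lastOf-∈ : ∀ (x : X) xs → lastOf x xs ∈ x ∷ xs
lastOf-∈ x []       = here refl
lastOf-∈ x (y ∷ ys) = there (lastOf-∈ y ys)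

touched-links : ∀ {z} (x : Fin b) xs → Touched z (links x xs) → z ∈ x ∷ xs
touched-links x (y ∷ ys) (here (inj₁ eq)) = here eq
touched-links x (y ∷ ys) (here (inj₂ eq)) = there (here eq)
touched-links x (y ∷ ys) (there t)        = there (touched-links y ys t)

touched-end : ∀ {z} l (x : Fin b) → Touched z (end l x) → z ≡ x
touched-end true x (here (inj₁ eq)) = eq
touched-end true x (here (inj₂ eq)) = eq

touched-box : ∀ {z} (p : Piece b) → Touched z (edgesOf p) → z ∈ boxesOf p
touched-box (row l x xs r) t with ListAny.++⁻ (end l x) t
... | inj₁ tˡ = here (touched-end l x tˡ)
... | inj₂ t′ with ListAny.++⁻ (end r (lastOf x xs)) t′
...   | inj₁ tʳ rewrite touched-end r (lastOf x xs) tʳ = lastOf-∈ x xs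
...   | inj₂ tᵐ = touched-links x xs tᵐ
touched-box (cyc x xs) (here (inj₁ refl)) = lastOf-∈ x xs
touched-box (cyc x xs) (here (inj₂ refl)) = here refl
touched-box (cyc x xs) (there t)          = touched-links x xs t

touched-boxes : ∀ {z} (ps : List (Piece b)) → Touched z (concatMap edgesOf ps) → z ∈ concatMap boxesOf ps
touched-boxes (p ∷ ps) t with ListAny.++⁻ (edgesOf p) t
... | inj₁ tᵖ  = ∈-++⁺ˡ (touched-box p tᵖ)
... | inj₂ tᵖˢ = ∈-++⁺ʳ (boxesOf p) (touched-boxes ps tᵖˢ)

-- Claimed boxes stay in the layout as pieces without edges, so that the pieces always partition the
-- fixed index set `Fin b`.
record Layout (ls : Vec (Line b) k) (ps : List (Piece b)) : Set where
  constructor layout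
  field
    boxes-↭ : concatMap boxesOf ps ↭ List.allFin b
    edges-↭ : edges ls ↭ concatMap edgesOf ps

layout-resp-↭ : ∀ {ls : Vec (Line b) k} {ps qs} → ps ↭ qs → Layout ls ps → Layout ls qs
layout-resp-↭ p (layout bs es) =
  layout (↭-trans (concatMap-↭ boxesOf (↭-sym p)) bs) (↭-trans es (concatMap-↭ edgesOf p))

live-unclaimed : ∀ {ls : Vec (Line b) k} {ps p s} → Layout ls ps → p ∈ ps → shape p ≡ just s →
                 All (Unclaimed ls) (boxesOf p)
live-unclaimed {ls = ls} {ps} {p} L p∈ eq with qs , π ← ∈-extract p∈ =
  All.map (touched⁻ ls ∘ Any-resp-↭ (↭-sym (Layout.edges-↭ (layout-resp-↭ π L))) ∘ ListAny.++⁺ˡ)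
          (live-touched p eq)

dead-row : ∀ (p : Piece b) → shape p ≡ nothing → ∃[ x ] p ≡ row false x [] false
dead-row (row true  x xs true)        ()
dead-row (row true  x xs false)       ()
dead-row (row false x [] true)        ()
dead-row (row false x (_ ∷ _) true)   ()
dead-row (row false x [] false)       _ = x , refl
dead-row (row false x (_ ∷ _) false)  ()
dead-row (cyc x [])                   ()
dead-row (cyc x (_ ∷ _))              ()

-- The box has no edge in its own piece, and no other piece contains it because the boxes of a
-- layout are distinct.
dead-claimed : ∀ {ls : Vec (Line b) k} {ps p} → Layout ls ps → p ∈ ps → shape p ≡ nothing →
               All (¬_ ∘ Unclaimed ls) (boxesOf p)
dead-claimed {b = b} {ls = ls} {p = p} L p∈ eq
  with qs , π ← ∈-extract p∈
  with x , refl ← dead-row p eq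
  with layout bs es ← layout-resp-↭ π L
  with x∉ ∷ _ ← PermSetoid.Unique-resp-↭ (setoid (Fin b)) (↭⇒↭ₛ (↭-sym bs)) (Unique.allFin⁺ b)
  = (λ u → All.lookup x∉ (touched-boxes qs (Any-resp-↭ es (touched⁺ ls u))) refl) ∷ []

count-filter : ∀ {P : X → Set} (P? : Decidable P) (xs : Vec X n) →
               Vec.count P? xs ≡ length (filter P? (toList xs))
count-filter P? []       = refl
count-filter P? (x ∷ xs) with does (P? x)
... | true  = cong suc (count-filter P? xs)
... | false = count-filter P? xs

toList-tabulate : ∀ (f : Fin n → X) → toList (tabulate f) ≡ List.tabulate f
toList-tabulate {n = zero}  f = refl
toList-tabulate {n = suc n} f = cong (f zero ∷_) (toList-tabulate (f ∘ suc))

filter-concatMap : ∀ {P : Y → Set} (P? : Decidable P) (f : X → List Y) (w : X → ℕ) {xs} →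
                   All (λ x → length (filter P? (f x)) ≡ w x) xs →
                   length (filter P? (concatMap f xs)) ≡ sum (List.map w xs)
filter-concatMap P? f w []                     = refl
filter-concatMap P? f w {x ∷ xs} (eq ∷ eqs)
  rewrite List.filter-++ P? (f x) (concatMap f xs)
        | List.length-++ (filter P? (f x)) {filter P? (concatMap f xs)}
  = cong₂ _+_ eq (filter-concatMap P? f w eqs)

sum-map-zero : ∀ (xs : List X) → sum (List.map (λ _ → 0) xs) ≡ 0
sum-map-zero []       = refl
sum-map-zero (_ ∷ xs) = sum-map-zero xs

module _ {ls : Vec (Line b) (suc k)} {p e ps qs} (L : Layout ls (p ∷ qs)) (cut : Cut p e ps)
         {i} (eq : e ≡ edge (lookup ls i)) where

  cut-layout : Layout (removeAt ls i) (ps ++ qs)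
  cut-layout = layout
    (↭-trans (↭-reflexive (List.concatMap-++ boxesOf ps qs))
      (↭-trans (++⁺ʳ _ (↭-sym (cut-boxes cut))) (Layout.boxes-↭ L)))
    (drop-∷ (↭-trans (↭-sym (subst (λ e → edges ls ↭ e ∷ _) (sym eq) (map⁺ edge (removeAt-↭ ls i))))
      (↭-trans (Layout.edges-↭ L)
        (↭-trans (++⁺ʳ _ (cut-edges cut))
          (prep _ (↭-reflexive (sym (List.concatMap-++ edgesOf ps qs))))))))

  private
    Fresh : Fin b → Set
    Fresh x = Unclaimed ls x × ¬ Unclaimed (removeAt ls i) x

    fresh? : Decidable Fresh
    fresh? x = unclaimed? ls x ×-dec ¬? (unclaimed? (removeAt ls i) x)

    fresh-ps : ∀ {q} → q ∈ ps → length (filter fresh? (boxesOf q)) ≡ claimed q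
    fresh-ps {q} q∈ with shape q in eq′
    ... | just _  = cong length (List.filter-none fresh?
                      (All.map (λ u (_ , ¬u) → ¬u u) (live-unclaimed cut-layout (∈-++⁺ˡ q∈) eq′)))
    ... | nothing with x , refl ← dead-row q eq′
        = cong length (List.filter-all fresh? (All.zip (x∈ ∷ [] , dead-claimed cut-layout (∈-++⁺ˡ q∈) eq′)))
      where
      x∈p : x ∈ boxesOf p
      x∈p with h , t , refl ← ∈-∃++ q∈ = ∈-resp-↭ (↭-sym (cut-boxes cut))
        (subst (x ∈_) (sym (List.concatMap-++ boxesOf h _)) (∈-++⁺ʳ (concatMap boxesOf h) (here refl)))

      x∈ : Unclaimed ls x
      x∈ = All.lookup (live-unclaimed L (here refl) (proj₁ (proj₂ (proj₂ (cut-step cut))))) x∈p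

    fresh-qs : ∀ {q} → q ∈ qs → length (filter fresh? (boxesOf q)) ≡ 0
    fresh-qs {q} q∈ with shape q in eq′
    ... | just _  = cong length (List.filter-none fresh?
                      (All.map (λ u (_ , ¬u) → ¬u u) (live-unclaimed cut-layout (∈-++⁺ʳ ps q∈) eq′)))
    ... | nothing = cong length (List.filter-none fresh?
                      (All.map (λ ¬u (u , _) → ¬u u) (dead-claimed L (there q∈) eq′)))

  -- Boxes outside the cut piece keep their status. Those of the cut piece were all unclaimed, since
  -- it has a shape, and afterwards exactly those in pieces without a shape are claimed.
  cut-claims : claims ls i ≡ dead ps
  cut-claims = begin
    claims ls i
      ≡⟨ count-filter fresh? (Vec.allFin b) ⟩
    length (filter fresh? (toList (Vec.allFin b)))
      ≡⟨ cong (length ∘ filter fresh?) (toList-tabulate id) ⟩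
    length (filter fresh? (List.allFin b))
      ≡⟨ ↭-length (filter-↭ fresh? (Layout.boxes-↭ cut-layout)) ⟨
    length (filter fresh? (concatMap boxesOf (ps ++ qs)))
      ≡⟨ cong (length ∘ filter fresh?) (List.concatMap-++ boxesOf ps qs) ⟩
    length (filter fresh? (concatMap boxesOf ps ++ concatMap boxesOf qs))
      ≡⟨ cong length (List.filter-++ fresh? (concatMap boxesOf ps) _) ⟩
    length (filter fresh? (concatMap boxesOf ps) ++ filter fresh? (concatMap boxesOf qs))
      ≡⟨ List.length-++ (filter fresh? (concatMap boxesOf ps)) ⟩
    length (filter fresh? (concatMap boxesOf ps)) + length (filter fresh? (concatMap boxesOf qs))
      ≡⟨ cong₂ _+_ (filter-concatMap fresh? boxesOf claimed (All.tabulate fresh-ps))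
                   (filter-concatMap fresh? boxesOf (λ _ → 0) (All.tabulate fresh-qs)) ⟩
    dead ps + sum (List.map (λ _ → 0) qs)
      ≡⟨ cong (λ t → dead ps + t) (sum-map-zero qs) ⟩
    dead ps + 0
      ≡⟨ +-identityʳ (dead ps) ⟩
    dead ps ∎
    where open ≡-Reasoning

-- Moves of positions as moves of shapes

record Rep (ls : Vec (Line b) k) (P : List Shape) : Set where
  constructor rep
  field
    {pieces}  : List (Piece b)
    has       : Layout ls pieces
    shapes-↭  : shapes pieces ↭ P

rep-resp-↭ : ∀ {ls : Vec (Line b) k} {P Q} → P ↭ Q → Rep ls P → Rep ls Q
rep-resp-↭ π (rep L σ) = rep L (↭-trans σ π)

shapes-∷ : ∀ (p : Piece b) {s} ps → shape p ≡ just s → shapes (p ∷ ps) ≡ s ∷ shapes ps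
shapes-∷ p ps eq rewrite eq = refl

∈-shapes⁻ : ∀ {s} (ps : List (Piece b)) → s ∈ shapes ps → ∃[ p ] p ∈ ps × shape p ≡ just s
∈-shapes⁻ (p ∷ ps) s∈ with shape p in eq
∈-shapes⁻ (p ∷ ps) (here refl) | just _ = p , here refl , eq
∈-shapes⁻ (p ∷ ps) (there s∈)  | just _  with q , q∈ , eq′ ← ∈-shapes⁻ ps s∈ = q , there q∈ , eq′
∈-shapes⁻ (p ∷ ps) s∈          | nothing with q , q∈ , eq′ ← ∈-shapes⁻ ps s∈ = q , there q∈ , eq′

∈-edges⁻ : ∀ {e} (ps : List (Piece b)) → e ∈ concatMap edgesOf ps → ∃[ p ] p ∈ ps × e ∈ edgesOf p
∈-edges⁻ (p ∷ ps) e∈ with ∈-++⁻ (edgesOf p) e∈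
... | inj₁ e∈p = p , here refl , e∈p
... | inj₂ e∈ps with q , q∈ , e∈q ← ∈-edges⁻ ps e∈ps = q , there q∈ , e∈q

cut-shapes : ∀ (p : Piece b) ps qs {s ss Q} → shape p ≡ just s → shapes (p ∷ qs) ↭ s ∷ Q →
             shapes ps ↭ ss → shapes (ps ++ qs) ↭ ss ++ Q
cut-shapes p ps qs eq σ τ =
  ↭-trans (↭-reflexive (List.mapMaybe-++ shape ps qs))
    (++⁺ τ (drop-∷ (↭-trans (↭-reflexive (sym (shapes-∷ p qs eq))) σ)))

rep-nonempty : ∀ {ls : Vec (Line b) 0} {s Q} → ¬ Rep ls (s ∷ Q)
rep-nonempty {ls = []} (rep {pieces = ps} L σ) with p , p∈ , eq ← ∈-shapes⁻ ps (∈-resp-↭ (↭-sym σ) (here refl))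
  with p | live-unclaimed L p∈ eq
... | row _ _ _ _ | () ∷ _
... | cyc _ _     | () ∷ _

-- Serves upper bounds: a move chosen on shapes can be played in every position with these shapes.
realize : ∀ {ls : Vec (Line b) (suc k)} {s ss Q} → Rep ls (s ∷ Q) → s ⟶⟨ n ⟩ ss →
          ∃[ i ] claims ls i ≡ n × Rep (removeAt ls i) (ss ++ Q)
realize {ls = ls} (rep {pieces = cs} L σ) st
  with p , p∈ , eq ← ∈-shapes⁻ cs (∈-resp-↭ (↭-sym σ) (here refl))
  with qs , π ← ∈-extract p∈
  with e , ps , cut , refl , τ ← step-cut p st eq
  with L′ ← layout-resp-↭ π L
  with _ , l∈ , refl ← ∈-map⁻ edge
         (∈-resp-↭ (↭-sym (↭-trans (Layout.edges-↭ L′) (++⁺ʳ _ (cut-edges cut)))) (here refl))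
  with i , refl ← ∈-toList⁻ ls l∈
  = i , cut-claims L′ cut refl ,
    rep (cut-layout L′ cut refl) (cut-shapes p ps qs eq (↭-trans (mapMaybe-↭ shape (↭-sym π)) σ) τ)

-- Serves lower bounds: any drawn line lies in some piece, so the move acts on the shape of that
-- piece alone.
analyse : ∀ {ls : Vec (Line b) (suc k)} {P} → Rep ls P → ∀ i →
          ∃[ s ] ∃[ ss ] ∃[ Q ] P ↭ s ∷ Q × s ⟶⟨ claims ls i ⟩ ss × Rep (removeAt ls i) (ss ++ Q)
analyse {ls = ls} {P} (rep {pieces = cs} L σ) i
  with p , p∈ , e∈ ← ∈-edges⁻ cs
         (∈-resp-↭ (↭-trans (↭-sym (map⁺ edge (removeAt-↭ ls i))) (Layout.edges-↭ L)) (here refl))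
  with ps , cut ← edge-cut p e∈
  with qs , π ← ∈-extract p∈
  with s , ss , eq , st , τ ← cut-step cut
  with L′ ← layout-resp-↭ π L
  = s , ss , shapes qs , ↭-trans (↭-sym σ) π′ ,
    subst (s ⟶⟨_⟩ ss) (sym (cut-claims L′ cut refl)) st ,
    rep (cut-layout L′ cut refl) (cut-shapes p ps qs eq (↭-reflexive (shapes-∷ p qs eq)) τ)
  where
  π′ : shapes cs ↭ s ∷ shapes qs
  π′ = ↭-trans (mapMaybe-↭ shape π) (↭-reflexive (shapes-∷ p qs eq))

-- Bounds on the value

foldr₁-≤ : ∀ (f : Fin (suc n) → ℤ) i → foldr₁ _⊓_ (tabulate f) ≤ f i
foldr₁-≤ {n = zero}  f zero    = ℤ.≤-refl
foldr₁-≤ {n = suc n} f zero    = ℤ.i⊓j≤i _ _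
foldr₁-≤ {n = suc n} f (suc i) = ℤ.≤-trans (ℤ.i⊓j≤j (f zero) _) (foldr₁-≤ (f ∘ suc) i)

foldr₁-glb : ∀ (f : Fin (suc n) → ℤ) {x} → (∀ i → x ≤ f i) → x ≤ foldr₁ _⊓_ (tabulate f)
foldr₁-glb {n = zero}  f x≤ = x≤ zero
foldr₁-glb {n = suc n} f x≤ = ℤ.⊓-glb (x≤ zero) (foldr₁-glb (f ∘ suc) (x≤ ∘ suc))

outcome : Vec (Line b) (suc k) → Fin (suc k) → ℤ
outcome ls i = afterMove (claims ls i) (value (removeAt ls i))

-- Quantifying over all positions with shapes `P` allows arguments on shapes alone, without a value
-- function for shapes.
Upper Lower : List Shape → ℤ → Set
Upper P x = ∀ {b k} (ls : Vec (Line b) k) → Rep ls P → value ls ≤ x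
Lower P x = ∀ {b k} (ls : Vec (Line b) k) → Rep ls P → x ≤ value ls

upper-pass : ∀ {s ss Q x} → s ⟶⟨ 0 ⟩ ss → Lower (ss ++ Q) x → Upper (s ∷ Q) (- x)
upper-pass st lo {k = zero}  ls R = contradiction R rep-nonempty
upper-pass st lo {k = suc _} ls R with i , eq , R′ ← realize R st =
  ℤ.≤-trans (foldr₁-≤ (outcome ls) i) (subst (λ c → afterMove c (value (removeAt ls i)) ≤ _) (sym eq)
    (ℤ.neg-mono-≤ (lo (removeAt ls i) R′)))

upper-claim : ∀ {s ss Q x} → s ⟶⟨ suc n ⟩ ss → Upper (ss ++ Q) x → Upper (s ∷ Q) (x - + suc n)
upper-claim st up {k = zero}  ls R = contradiction R rep-nonempty
upper-claim st up {k = suc _} ls R with i , eq , R′ ← realize R st =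
  ℤ.≤-trans (foldr₁-≤ (outcome ls) i) (subst (λ c → afterMove c (value (removeAt ls i)) ≤ _) (sym eq)
    (ℤ.+-monoˡ-≤ (- + suc _) (up (removeAt ls i) R′)))

-- The bound required after a move claiming `n` boxes for that move to yield at least `x`. If
-- nothing is claimed the turn passes, which negates the value and turns a lower bound into an upper
-- one.
Continues : ℕ → List Shape → ℤ → Set
Continues zero    P x = Upper P (- x)
Continues (suc n) P x = Lower P (x ℤ.+ + suc n)

continues-≤ : ∀ n {P x} {ls : Vec (Line b) k} → Continues n P x → Rep ls P → x ≤ afterMove n (value ls)
continues-≤ zero    {x = x} {ls} up R =
  subst (ℤ._≤ - value ls) (ℤ.neg-involutive x) (ℤ.neg-mono-≤ (up ls R))
continues-≤ (suc n) {x = x} {ls} lo R =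
  subst (ℤ._≤ value ls - + suc n)
        (trans (ℤ.+-assoc x (+ suc n) (- + suc n))
          (trans (cong (λ y → x ℤ.+ y) (ℤ.+-inverseʳ (+ suc n))) (ℤ.+-identityʳ x)))
        (ℤ.+-monoˡ-≤ (- + suc n) (lo ls R))

lower-∷ : ∀ {s₀ P₀ x} →
          (∀ {s ss Q n} → s₀ ∷ P₀ ↭ s ∷ Q → s ⟶⟨ n ⟩ ss → Continues n (ss ++ Q) x) →
          Lower (s₀ ∷ P₀) x
-- A remaining shape has a line, so the default value 0 of a position without lines cannot occur.
lower-∷ f {k = zero}  ls R = contradiction R rep-nonempty
lower-∷ f {k = suc _} ls R = foldr₁-glb (outcome ls) λ i →
  let s , ss , Q , π , st , R′ = analyse R i in continues-≤ (claims ls i) (f π st) R′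

value-[] : ∀ {ls : Vec (Line b) k} → Rep ls [] → value ls ≡ + 0
value-[] {k = zero} R = refl
value-[] {k = suc _} R with analyse R zero
... | _ , _ , _ , π , _ with () ← ↭-length π

private
  variable
    s : Shape
    S E P Q ss : List Shape
    x y : ℤ

-- Controlled play

data Opened : Shape → Set where
  A : ∀ n → Opened (A n)
  B : ∀ n → Opened (B n)

-- The offsets demand at least 3 boxes in a chain and 4 in a loop, enough to decline 2 or 4 of them
-- after the opening.
data Closed : Shape → Set where
  C : ∀ n → Closed (C (2 + n))
  O : ∀ n → Closed (O (2 + n))

boxCount : Shape → ℕ
boxCount (A n) = 1 + n
boxCount (B n) = 2 + n
boxCount (C n) = 1 + n
boxCount (O n) = 2 + n

boxCounts : List Shape → ℕ
boxCounts = sum ∘ List.map boxCount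

-- Opening a chain hands over all its boxes but the last two, opening a loop
-- all but the last four; the player in control declines those or not.
cost : Closed s → ℤ → ℤ
cost (C n) x = + suc n ℤ.+ + ∣ x - + 2 ∣
cost (O n)  x = + n ℤ.+ + ∣ x - + 4 ∣

-- Naming the difference `d` as a natural number reduces inequalities with absolute values to ring
-- identities.
≤-slack : ∀ d → y ≡ x ℤ.+ + d → x ≤ y
≤-slack {x = x} d refl = ℤ.i≤i+j x (+ d)

∣∣-slack⁺ : ∀ z → ∃[ d ] + ∣ z ∣ ≡ z ℤ.+ + d
∣∣-slack⁺ (+ n)      = 0 , sym (ℤ.+-identityʳ _)
∣∣-slack⁺ (-[1+ n ]) = suc n + suc n , sym (trans (sym (ℤ.+-assoc -[1+ n ] (+ suc n) (+ suc n)))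
                                              (cong (ℤ._+ + suc n) (ℤ.+-inverseˡ (+ suc n))))

∣∣-slack⁻ : ∀ z → ∃[ d ] + ∣ z ∣ ≡ - z ℤ.+ + d
∣∣-slack⁻ z with d , eq ← ∣∣-slack⁺ (- z) = d , trans (cong +_ (sym (ℤ.∣-i∣≡∣i∣ z))) eq

∣∣-cases : ∀ z → + ∣ z ∣ ≡ z ⊎ + ∣ z ∣ ≡ - z
∣∣-cases (+ n)      = inj₁ refl
∣∣-cases (-[1+ n ]) = inj₂ refl

module _ (t n : ℕ) (x : ℤ) where

  private
    a = + ∣ x - + t ∣

  -- Here `t` counts the boxes to be declined, `n` the other boxes of the string, and `- (n + a)` is
  -- the value claimed for the string next to an endgame of value `x`. This bound deals with moves
  -- outside the string.
  keep-≤ : - (+ n ℤ.+ a) ≤ x ℤ.+ + (t + n)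
  keep-≤ with d , eq ← ∣∣-slack⁻ (x - + t) =
    ≤-slack e (trans (lemma x (+ t) (+ n) (+ d)) (cong (λ a → - (+ n ℤ.+ a) ℤ.+ + e) (sym eq)))
    where
    e = d + (n + n + (t + t))
    lemma : ∀ x t n d → x ℤ.+ (t ℤ.+ n) ≡ - (n ℤ.+ (- (x - t) ℤ.+ d)) ℤ.+ (d ℤ.+ (n ℤ.+ n ℤ.+ (t ℤ.+ t)))
    lemma = ℤRing.solve-∀

  -- Passing the turn too early lets the opponent take all `t + n` boxes.
  take-all-≤ : x - + (t + n) ≤ - (- (+ n ℤ.+ a))
  take-all-≤ with d , eq ← ∣∣-slack⁺ (x - + t) =
    ≤-slack (d + (n + n)) (trans (cong (λ a → - (- (+ n ℤ.+ a))) eq) (lemma x (+ t) (+ n) (+ d)))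
    where
    lemma : ∀ x t n d → - (- (n ℤ.+ ((x - t) ℤ.+ d))) ≡ x - (t ℤ.+ n) ℤ.+ (d ℤ.+ (n ℤ.+ n))
    lemma = ℤRing.solve-∀

  -- The base case, with exactly `t` boxes left: after taking one of them the option to decline is
  -- gone, and `t - 1` boxes remain to be taken.
  take-last-≤ : - (0ℤ ℤ.+ a) ℤ.+ + 1 ≤ x - + t ℤ.+ + 1
  take-last-≤ with d , eq ← ∣∣-slack⁻ (x - + t) =
    ≤-slack d (trans (lemma x (+ t) (+ d)) (cong (λ a → - (0ℤ ℤ.+ a) ℤ.+ + 1 ℤ.+ + d) (sym eq)))
    where
    lemma : ∀ x t d → x - t ℤ.+ + 1 ≡ - (0ℤ ℤ.+ (- (x - t) ℤ.+ d)) ℤ.+ + 1 ℤ.+ d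
    lemma = ℤRing.solve-∀

upper-≤ : x ≤ y → Upper P x → Upper P y
upper-≤ x≤y up ls R = ℤ.≤-trans (up ls R) x≤y

lower-≤ : x ≤ y → Lower P y → Lower P x
lower-≤ x≤y lo ls R = ℤ.≤-trans x≤y (lo ls R)

upper-resp-↭ : P ↭ Q → Upper P x → Upper Q x
upper-resp-↭ π up ls R = up ls (rep-resp-↭ (↭-sym π) R)

lower-resp-↭ : P ↭ Q → Lower P x → Lower Q x
lower-resp-↭ π lo ls R = lo ls (rep-resp-↭ (↭-sym π) R)

continues-resp-↭ : ∀ n → P ↭ Q → Continues n P x → Continues n Q x
continues-resp-↭ zero    = upper-resp-↭
continues-resp-↭ (suc n) = lower-resp-↭

sub-sub : ∀ x m n → x - + m - + n ≡ x - + (n + m)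
sub-sub x m n = lemma x (+ m) (+ n)
  where
  lemma : ∀ x m n → x - m - n ≡ x - (n ℤ.+ m)
  lemma = ℤRing.solve-∀

-- A string can be emptied from one end without ever passing the turn.
greedy₁ : Opened s → Upper Q x → Upper (s ∷ Q) (x - + boxCount s)
greedy₁ (A zero)    up = upper-claim A-last up
greedy₁ {Q = Q} {x} (A (suc n)) up =
  subst (Upper (A (suc n) ∷ Q)) (sub-sub x (suc n) 1) (upper-claim A-take (greedy₁ (A n) up))
greedy₁ (B zero)    up = upper-claim B-last up
greedy₁ {Q = Q} {x} (B (suc n)) up =
  subst (Upper (B (suc n) ∷ Q)) (sub-sub x (2 + n) 1) (upper-claim B-take (greedy₁ (B n) up))

greedy : All Opened S → Upper Q x → Upper (S ++ Q) (x - + boxCounts S)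
greedy {x = x} []                     up = subst (Upper _) (sym (ℤ.+-identityʳ x)) up
greedy {S = s ∷ S} {Q} {x} (op ∷ ops) up =
  subst (Upper (s ∷ S ++ Q)) (sub-sub x (boxCounts S) (boxCount s)) (greedy₁ op (greedy ops up))

-- `opening` records the lower bound for each first move separately. In this form it can be used
-- while opened strings are present, because the answering player may empty them first.
record Solved (E : List Shape) (x : ℤ) : Set where
  field
    upper   : Upper E x
    lower   : Lower E x
    opening : E ↭ s ∷ Q → s ⟶⟨ n ⟩ ss → n ≡ 0 × Upper (ss ++ Q) (- x)

open Solved

solved-resp-↭ : P ↭ Q → Solved P x → Solved Q x
solved-resp-↭ π sol = record
  { upper   = upper-resp-↭ π (upper sol)
  ; lower   = lower-resp-↭ π (lower sol)
  ; opening = λ σ → opening sol (↭-trans π σ)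
  }

++-↭-∷ : ∀ (xs : List X) {ys z zs} → xs ++ ys ↭ z ∷ zs →
         (∃[ xs′ ] xs ↭ z ∷ xs′ × zs ↭ xs′ ++ ys) ⊎ (∃[ ys′ ] ys ↭ z ∷ ys′ × zs ↭ xs ++ ys′)
++-↭-∷ xs {ys} {z} π with ∈-++⁻ xs (∈-resp-↭ (↭-sym π) (here refl))
... | inj₁ z∈ with xs′ , σ ← ∈-extract z∈ = inj₁ (xs′ , σ , drop-∷ (↭-trans (↭-sym π) (++⁺ʳ ys σ)))
... | inj₂ z∈ with ys′ , σ ← ∈-extract z∈ =
  inj₂ (ys′ , σ , drop-∷ (↭-trans (↭-sym π) (↭-trans (++⁺ˡ xs σ) (shift z xs ys′))))

-- A move in E is answered by first taking all of S, so only moves in S remain.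
lower-opened : ∀ {s₀} → All Opened (s₀ ∷ S) → Solved E x → y ≤ x ℤ.+ + boxCounts (s₀ ∷ S) →
  (∀ {s ss S′ n} → s₀ ∷ S ↭ s ∷ S′ → s ⟶⟨ n ⟩ ss → Continues n (ss ++ S′ ++ E) y) →
  Lower (s₀ ∷ S ++ E) y
lower-opened {S} {E} {x} {y} {s₀} ops sol y≤ f = lower-∷ step
  where
  lemma : ∀ x z → - x - z ≡ - (x ℤ.+ z)
  lemma = ℤRing.solve-∀

  step : ∀ {s ss Q n} → s₀ ∷ S ++ E ↭ s ∷ Q → s ⟶⟨ n ⟩ ss → Continues n (ss ++ Q) y
  step {ss = ss} {n = n} π st with ++-↭-∷ (s₀ ∷ S) π
  ... | inj₁ (S′ , σ , τ) = continues-resp-↭ n (++⁺ˡ ss (↭-sym τ)) (f σ st)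
  ... | inj₂ (E′ , σ , τ) with refl , up ← opening sol σ st =
    upper-≤ (subst (ℤ._≤ _) (sym (lemma x _)) (ℤ.neg-mono-≤ y≤))
      (upper-resp-↭ (↭-trans (shifts (s₀ ∷ S) ss) (++⁺ˡ ss (↭-sym τ))) (greedy ops up))

singleton-≡ : ∀ {xs : List X} {x y} → x ∷ [] ↭ y ∷ xs → y ≡ x × xs ≡ []
singleton-≡ π with refl ← ↭-singleton-inv (↭-sym π) = refl , refl

lower-opened₁ : ∀ {s₀} → Opened s₀ → Solved E x → y ≤ x ℤ.+ + boxCount s₀ →
  (∀ {ss n} → s₀ ⟶⟨ n ⟩ ss → Continues n (ss ++ E) y) → Lower (s₀ ∷ E) y
lower-opened₁ {E} {x} {y} {s₀} op sol y≤ f =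
  lower-opened (op ∷ []) sol (subst (λ k → y ≤ x ℤ.+ + k) (sym (+-identityʳ (boxCount s₀))) y≤) step
  where
  step : ∀ {s ss S′ n} → s₀ ∷ [] ↭ s ∷ S′ → s ⟶⟨ n ⟩ ss → Continues n (ss ++ S′ ++ E) y
  step π st with refl , refl ← singleton-≡ π = f st

sub-≤-add : ∀ x m n → x - + m ≤ x ℤ.+ + n
sub-≤-add x m n = ≤-slack (m + n) (lemma x (+ m) (+ n))
  where
  lemma : ∀ x m n → x ℤ.+ n ≡ x - m ℤ.+ (m ℤ.+ n)
  lemma = ℤRing.solve-∀

sub-add : ∀ x m n → x - + (n + m) ℤ.+ + n ≡ x - + m
sub-add x m n = lemma x (+ m) (+ n)
  where
  lemma : ∀ x m n → x - (n ℤ.+ m) ℤ.+ n ≡ x - m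
  lemma = ℤRing.solve-∀

module _ (sol : Solved E x) where

  lower-A₀ : Lower (A 0 ∷ E) (x - + 1)
  lower-A₀ = lower-opened₁ (A 0) sol (sub-≤-add x 1 1) λ where
    A-last → subst (Lower E) (sym (trans (sub-add x 0 1) (ℤ.+-identityʳ x))) (lower sol)

  -- `B 0` is the pair of boxes that the player in control gives up at the end of a chain.
  lower-B₀ : Lower (B 0 ∷ E) (x - + 2)
  lower-B₀ = lower-opened₁ (B 0) sol (sub-≤-add x 2 2) λ where
    B-last → subst (Lower E) (sym (trans (sub-add x 0 2) (ℤ.+-identityʳ x))) (lower sol)

  lower-B₁ : Lower (B 1 ∷ E) (x - + 3)
  lower-B₁ = lower-opened₁ (B 1) sol (sub-≤-add x 3 3) λ where
    B-take → subst (Lower (B 0 ∷ E)) (sym (sub-add x 2 1)) lower-B₀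

  -- Two such pairs are what the player in control gives up at the end of a loop.
  lower-B₀B₀ : Lower (B 0 ∷ B 0 ∷ E) (x - + 4)
  lower-B₀B₀ = lower-opened (B 0 ∷ B 0 ∷ []) sol (sub-≤-add x 4 4) step
    where
    step : B 0 ∷ B 0 ∷ [] ↭ s ∷ Q → s ⟶⟨ n ⟩ ss → Continues n (ss ++ Q ++ E) (x - + 4)
    step π st with ∈-resp-↭ (↭-sym π) (here refl)
    step π st | here refl with refl ← ↭-singleton-inv (↭-sym (drop-∷ π)) with B-last ← st =
      subst (Lower (B 0 ∷ E)) (sym (sub-add x 2 2)) lower-B₀
    step π st | there (here refl) with refl ← ↭-singleton-inv (↭-sym (drop-∷ π)) with B-last ← st =
      subst (Lower (B 0 ∷ E)) (sym (sub-add x 2 2)) lower-B₀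

  neg-suc : ∀ n a → - (+ suc n ℤ.+ a) ℤ.+ + 1 ≡ - (+ n ℤ.+ a)
  neg-suc n a = lemma (+ n) a
    where
    lemma : ∀ n a → - (+ 1 ℤ.+ n ℤ.+ a) ℤ.+ + 1 ≡ - (n ℤ.+ a)
    lemma = ℤRing.solve-∀

  -- Taking a box leads to a shorter string, and every other move in the string passes the turn and
  -- exposes all of it. With two boxes left, taking one destroys the option to decline.
  lower-A : ∀ n → Lower (A (suc n) ∷ E) (- (+ n ℤ.+ + ∣ x - + 2 ∣))
  lower-A n = lower-opened₁ (A (suc n)) sol (keep-≤ 2 n x) (step n)
    where
    step : ∀ n → A (suc n) ⟶⟨ k ⟩ ss → Continues k (ss ++ E) (- (+ n ℤ.+ + ∣ x - + 2 ∣))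
    step zero    A-take = lower-≤ (ℤ.≤-trans (take-last-≤ 2 0 x) (ℤ.≤-reflexive (lemma x))) lower-A₀
      where
      lemma : ∀ x → x - + 2 ℤ.+ + 1 ≡ x - + 1
      lemma = ℤRing.solve-∀
    step (suc n) A-take = lower-≤ (ℤ.≤-reflexive (neg-suc n (+ ∣ x - + 2 ∣))) (lower-A n)
    step n       A-far  = upper-≤ (take-all-≤ 2 n x) (greedy₁ (B n) (upper sol))
    step _ (A-mid {n} m) = upper-≤ (take-all-≤ 2 (suc (m + n)) x)
      (subst (Upper _) (cong (λ k → x - + k) (lemma m n)) (greedy (B m ∷ A n ∷ []) (upper sol)))
      where
      lemma : ∀ m n → boxCounts (B m ∷ A n ∷ []) ≡ 3 + (m + n)
      lemma m n rewrite +-identityʳ n | +-suc m n = refl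

  -- The argument of `lower-A`, with the option to decline destroyed when one of the last four boxes
  -- is taken.
  lower-B : ∀ n → Lower (B (2 + n) ∷ E) (- (+ n ℤ.+ + ∣ x - + 4 ∣))
  lower-B n = lower-opened₁ (B (2 + n)) sol (keep-≤ 4 n x) (step n refl)
    where
    step : ∀ n → m ≡ 2 + n → B m ⟶⟨ k ⟩ ss → Continues k (ss ++ E) (- (+ n ℤ.+ + ∣ x - + 4 ∣))
    step _ eq (B-mid {n} m) with refl ← eq = upper-≤ (take-all-≤ 4 (m + n) x)
      (subst (Upper _) (cong (λ k → x - + k) (lemma m n)) (greedy (B m ∷ B n ∷ []) (upper sol)))
      where
      lemma : ∀ m n → boxCounts (B m ∷ B n ∷ []) ≡ 4 + (m + n)
      lemma m n rewrite +-identityʳ n | +-suc m (suc n) | +-suc m n = refl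
    step n () B-last
    step zero    refl B-take = lower-≤ (ℤ.≤-trans (take-last-≤ 4 0 x) (ℤ.≤-reflexive (lemma x))) lower-B₁
      where
      lemma : ∀ x → x - + 4 ℤ.+ + 1 ≡ x - + 3
      lemma = ℤRing.solve-∀
    step (suc n) refl B-take = lower-≤ (ℤ.≤-reflexive (neg-suc n (+ ∣ x - + 4 ∣))) (lower-B n)

  -- If `x - 2` is nonnegative the player takes all but two boxes and passes by `A-far`; otherwise
  -- the whole string is taken.
  upper-A : ∀ n → Upper (A (suc n) ∷ E) (- (+ n ℤ.+ + ∣ x - + 2 ∣))
  upper-A n with ∣∣-cases (x - + 2)
  ... | inj₁ eq = subst (Upper (A (suc n) ∷ E))
                    (trans (lemma x (+ n)) (cong (λ a → - (+ n ℤ.+ a)) (sym eq))) (keep n)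
    where
    lemma : ∀ x n → - (x - + 2) - n ≡ - (n ℤ.+ (x - + 2))
    lemma = ℤRing.solve-∀
    keep : ∀ n → Upper (A (suc n) ∷ E) (- (x - + 2) - + n)
    keep zero    = subst (Upper _) (sym (ℤ.+-identityʳ _)) (upper-pass A-far lower-B₀)
    keep (suc n) = subst (Upper _) (sub-sub (- (x - + 2)) n 1) (upper-claim A-take (keep n))
  ... | inj₂ eq = subst (Upper (A (suc n) ∷ E)) (trans (lemma x (+ n)) (cong (λ a → - (+ n ℤ.+ a)) (sym eq)))
                    (greedy₁ (A (suc n)) (upper sol))
    where
    lemma : ∀ x n → x - (+ 2 ℤ.+ n) ≡ - (n ℤ.+ - (x - + 2))
    lemma = ℤRing.solve-∀

  -- If `x - 4` is nonnegative the player takes all but four boxes and passes by drawing the middle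
  -- line of these; otherwise the whole string is taken.
  upper-B : ∀ n → Upper (B (2 + n) ∷ E) (- (+ n ℤ.+ + ∣ x - + 4 ∣))
  upper-B n with ∣∣-cases (x - + 4)
  ... | inj₁ eq = subst (Upper (B (2 + n) ∷ E))
                    (trans (lemma x (+ n)) (cong (λ a → - (+ n ℤ.+ a)) (sym eq))) (keep n)
    where
    lemma : ∀ x n → - (x - + 4) - n ≡ - (n ℤ.+ (x - + 4))
    lemma = ℤRing.solve-∀
    keep : ∀ n → Upper (B (2 + n) ∷ E) (- (x - + 4) - + n)
    keep zero    = subst (Upper _) (sym (ℤ.+-identityʳ _)) (upper-pass (B-mid 0) lower-B₀B₀)
    keep (suc n) = subst (Upper _) (sub-sub (- (x - + 4)) n 1) (upper-claim B-take (keep n))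
  ... | inj₂ eq = subst (Upper (B (2 + n) ∷ E)) (trans (lemma x (+ n)) (cong (λ a → - (+ n ℤ.+ a)) (sym eq)))
                    (greedy₁ (B (2 + n)) (upper sol))
    where
    lemma : ∀ x n → x - (+ 4 ℤ.+ n) ≡ - (n ℤ.+ - (x - + 4))
    lemma = ℤRing.solve-∀

  -- One part is emptied first; the other has at least two boxes, so the choice of `upper-A` is
  -- still available there.
  upper-AA : ∀ m n → Upper (A m ∷ A (suc n) ∷ E) (- (+ suc (m + n) ℤ.+ + ∣ x - + 2 ∣))
  upper-AA m n = subst (Upper _) (lemma (+ m) (+ n) (+ ∣ x - + 2 ∣)) (greedy₁ (A m) (upper-A n))
    where
    lemma : ∀ m n a → - (n ℤ.+ a) - (+ 1 ℤ.+ m) ≡ - (+ 1 ℤ.+ (m ℤ.+ n) ℤ.+ a)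
    lemma = ℤRing.solve-∀

  -- Opening a chain in the middle is no better than at its end: of three or more boxes, one part
  -- keeps at least two. For a loop all openings are alike.
  upper-open : (c : Closed s) → s ⟶⟨ n ⟩ ss → n ≡ 0 × Upper (ss ++ E) (- cost c x)
  upper-open (C n) st = step refl st
    where
    step : m ≡ 2 + n → C m ⟶⟨ k ⟩ ss → k ≡ 0 × Upper (ss ++ E) (- cost (C n) x)
    step eq   (C-mid zero) with refl ← eq = refl , upper-AA 0 n
    step eq   (C-mid {zero} (suc m))  with refl ← trans (cong suc (sym (+-identityʳ m))) (suc-injective eq) =
      refl , upper-resp-↭ (swap _ _ refl) (upper-AA 0 m)
    step eq   (C-mid {suc n} (suc m)) with refl ← trans (sym (+-suc m n)) (suc-injective (suc-injective eq)) =
      refl , upper-AA (suc m) n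
    step refl C-end = refl , upper-A (suc n)
  upper-open (O n) O-cut = refl , upper-B n

  upper-closed : (c : Closed s) → Upper (s ∷ E) (cost c x)
  upper-closed (C n) = subst (Upper _) (ℤ.neg-involutive _) (upper-pass C-end (lower-A (suc n)))
  upper-closed (O n)  = subst (Upper _) (ℤ.neg-involutive _) (upper-pass O-cut (lower-B n))

solved-[] : Solved [] (+ 0)
solved-[] = record
  { upper   = λ ls R → ℤ.≤-reflexive (value-[] R)
  ; lower   = λ ls R → ℤ.≤-reflexive (sym (value-[] R))
  ; opening = λ π → λ where st → absurd (↭-length π)
  }
  where
  absurd : ∀ {X : Set} {n} → 0 ≡ suc n → X
  absurd ()

-- The minimum over all openings is given by an opening of cost at most `x` and the bound `x` on the
-- cost of every opening.
solved-∷ : ∀ {s₀ P₀} → All Closed (s₀ ∷ P₀) →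
  (∃[ s ] ∃[ Q ] ∃[ y ] s₀ ∷ P₀ ↭ s ∷ Q × Solved Q y × (∀ (c : Closed s) → cost c y ≤ x)) →
  (∀ {s Q} → s₀ ∷ P₀ ↭ s ∷ Q → ∃[ y ] Solved Q y × (∀ (c : Closed s) → x ≤ cost c y)) →
  Solved (s₀ ∷ P₀) x
solved-∷ {x = x} {s₀} {P₀} cl (s , Q , y , π , sol , cost≤) all = record
  { upper   = upper-resp-↭ (↭-sym π) (upper-≤ (cost≤ c) (upper-closed sol c))
  ; lower   = lower-∷ λ π st → continues (op π st)
  ; opening = op
  }
  where
  c : Closed s
  c with c ∷ _ ← All-resp-↭ π cl = c

  op : ∀ {s Q n ss} → s₀ ∷ P₀ ↭ s ∷ Q → s ⟶⟨ n ⟩ ss → n ≡ 0 × Upper (ss ++ Q) (- x)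
  op π st with c ∷ _ ← All-resp-↭ π cl with y , sol , x≤ ← all π with eq , up ← upper-open sol c st =
    eq , upper-≤ (ℤ.neg-mono-≤ (x≤ c)) up

  continues : ∀ {n P} → n ≡ 0 × Upper P (- x) → Continues n P x
  continues (refl , up) = up

-- The values of loops alone and together with a 3-chain

minimum : (Fin (suc n) → ℕ) → ℕ
minimum f = foldr₁ ℕ._⊓_ (tabulate f)

minimum-≤ : ∀ (f : Fin (suc n) → ℕ) i → minimum f ≤ℕ f i
minimum-≤ {n = zero}  f zero    = ≤-refl
minimum-≤ {n = suc n} f zero    = m⊓n≤m _ _
minimum-≤ {n = suc n} f (suc i) = ≤-trans (m⊓n≤n (f zero) _) (minimum-≤ (f ∘ suc) i)

minimum-sel : ∀ (f : Fin (suc n) → ℕ) → ∃[ i ] minimum f ≡ f i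
minimum-sel {n = zero}  f = zero , refl
minimum-sel {n = suc n} f with ⊓-sel (f zero) (minimum (f ∘ suc)) | minimum-sel (f ∘ suc)
... | inj₁ eq | _       = zero , eq
... | inj₂ eq | i , eq′ = suc i , trans eq eq′

-- ∣ 2 x - 4 ∣ = 2 ψ x,  ∣ 2 x - 2 ∣ = 2 χ x  and  ∣ (1 + 2 x) - 4 ∣ = 1 + 2 φ x.
ψ χ φ : ℕ → ℕ
ψ 0             = 2
ψ 1             = 1
ψ (suc (suc n)) = n
χ 0             = 1
χ (suc n)       = n
φ 0             = 1
φ 1             = 0
φ (suc (suc n)) = n

-- A loop of length 4 + 2 k is represented by k: loops with lengths ks have
-- value 2 h ks, and together with a 3-chain they have value 1 + 2 g ks.
h : Vec ℕ n → ℕ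
h {zero}  ks = 0
h {suc n} ks = minimum λ i → lookup ks i + ψ (h (removeAt ks i))

g : Vec ℕ n → ℕ
g {zero}  ks = 1
g {suc n} ks = χ (h ks) ℕ.⊓ minimum λ i → lookup ks i + φ (g (removeAt ks i))

total : Vec ℕ n → ℕ
total = sum ∘ toList

h-≤ : ∀ (ks : Vec ℕ (suc n)) i → h ks ≤ℕ lookup ks i + ψ (h (removeAt ks i))
h-≤ ks = minimum-≤ (λ i → lookup ks i + ψ (h (removeAt ks i)))

h-sel : ∀ (ks : Vec ℕ (suc n)) → ∃[ i ] h ks ≡ lookup ks i + ψ (h (removeAt ks i))
h-sel ks = minimum-sel (λ i → lookup ks i + ψ (h (removeAt ks i)))

g-≤-χ : ∀ (ks : Vec ℕ n) → g ks ≤ℕ χ (h ks)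
g-≤-χ {zero}  ks = ≤-refl
g-≤-χ {suc n} ks = m⊓n≤m _ _

g-≤ : ∀ (ks : Vec ℕ (suc n)) i → g ks ≤ℕ lookup ks i + φ (g (removeAt ks i))
g-≤ ks i = ≤-trans (m⊓n≤n (χ (h ks)) _) (minimum-≤ (λ i → lookup ks i + φ (g (removeAt ks i))) i)

g-sel : ∀ (ks : Vec ℕ (suc n)) →
        g ks ≡ χ (h ks) ⊎ (∃[ i ] g ks ≡ lookup ks i + φ (g (removeAt ks i)))
g-sel ks with ⊓-sel (χ (h ks)) (minimum (λ i → lookup ks i + φ (g (removeAt ks i))))
                | minimum-sel (λ i → lookup ks i + φ (g (removeAt ks i)))
... | inj₁ eq | _       = inj₁ eq
... | inj₂ eq | i , eq′ = inj₂ (i , trans eq eq′)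

total-removeAt : ∀ (ks : Vec ℕ (suc n)) i → total ks ≡ lookup ks i + total (removeAt ks i)
total-removeAt ks i = sum-↭ (removeAt-↭ ks i)

x≤2+ψx : ∀ x → x ≤ℕ 2 + ψ x
x≤2+ψx 0             = z≤n
x≤2+ψx 1             = s≤s z≤n
x≤2+ψx (suc (suc x)) = ≤-refl

x≤2+φx : ∀ x → x ≤ℕ 2 + φ x
x≤2+φx 0             = z≤n
x≤2+φx 1             = s≤s z≤n
x≤2+φx (suc (suc x)) = ≤-refl

x≤1+χx : ∀ x → x ≤ℕ 1 + χ x
x≤1+χx 0       = z≤n
x≤1+χx (suc x) = ≤-refl

-- The controlled values of the loops and of 3 + loops are
-- 8 + 2 (total ks) - 4 n and 5 + 2 (total ks) - 4 n: they bound h and g from below.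
cv-step : ∀ c k t {u} n {x y} → x ≤ℕ 2 + y → c + t ≤ℕ x + 2 * n → u ≡ k + t →
          c + u ≤ℕ (k + y) + 2 * suc n
cv-step c k t n {x} {y} x≤ le refl = begin
  c + (k + t)             ≡⟨ lemma₁ c k t ⟩
  k + (c + t)             ≤⟨ +-monoʳ-≤ k (≤-trans le (+-monoˡ-≤ (2 * n) x≤)) ⟩
  k + (2 + y + 2 * n)     ≡⟨ lemma₂ k y n ⟩
  (k + y) + 2 * suc n     ∎
  where
  open ≤-Reasoning
  lemma₁ : ∀ c k t → c + (k + t) ≡ k + (c + t)
  lemma₁ = solve-∀
  lemma₂ : ∀ k y n → k + (2 + y + 2 * n) ≡ (k + y) + 2 * suc n
  lemma₂ = solve-∀

-- Opening loop `k` gives `k + ψ x`, at least `k + x - 2`, and `k - 2` is half of what the loop adds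
-- to the controlled value.
h-lower : ∀ (ks : Vec ℕ (suc n)) → 4 + total ks ≤ℕ h ks + 2 * suc n
h-lower {zero}  (k ∷ []) rewrite +-identityʳ k = ≤-reflexive (lemma k)
  where
  lemma : ∀ k → 4 + k ≡ k + 2 + 2
  lemma = solve-∀
h-lower {suc n} ks with i , eq ← h-sel ks rewrite eq =
  cv-step 4 (lookup ks i) _ (suc n) (x≤2+ψx _) (h-lower (removeAt ks i)) (total-removeAt ks i)

-- For a loop the induction is that of `h-lower`; opening the chain instead reduces to `h-lower`
-- through `χ x ≥ x - 1`.
g-lower : ∀ (ks : Vec ℕ (suc n)) → 2 + total ks ≤ℕ g ks + 2 * suc n
g-lower {n} ks with g-sel ks
... | inj₁ eq rewrite eq = +-cancelˡ-≤ 1 _ _ (begin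
  3 + total ks                  ≤⟨ n≤1+n _ ⟩
  4 + total ks                  ≤⟨ h-lower ks ⟩
  h ks + 2 * suc n              ≤⟨ +-monoˡ-≤ (2 * suc n) (x≤1+χx (h ks)) ⟩
  1 + χ (h ks) + 2 * suc n      ∎)
  where open ≤-Reasoning
g-lower {zero}  (k ∷ []) | inj₂ (zero , eq) rewrite eq | +-identityʳ k = ≤-reflexive (+-comm 2 k)
g-lower {suc n} ks       | inj₂ (i , eq) rewrite eq =
  cv-step 2 (lookup ks i) _ (suc n) (x≤2+φx _) (g-lower (removeAt ks i)) (total-removeAt ks i)

-- 3 + loops with controlled value at least 2

small-loop : ∀ (ks : Vec ℕ n) → total ks < 2 * n → ∃[ i ] lookup ks i ≤ℕ 1
small-loop {suc n} (0 ∷ ks)           lt = zero , z≤n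
small-loop {suc n} (1 ∷ ks)           lt = zero , s≤s z≤n
small-loop {suc n} (suc (suc k) ∷ ks) lt
  with i , le ← small-loop ks (≤-trans (s≤s (m≤n+m (total ks) k))
                  (+-cancelˡ-≤ 2 _ _ (subst (3 + (k + total ks) ≤ℕ_) (*-suc 2 n) lt)))
  = suc i , le

-- If dropping the head leaves too little, the tail has an entry of at most 1, and dropping that one
-- lowers the total by at most 1.
drop-loop : ∀ (ks : Vec ℕ (suc n)) → 2 * n < total ks → ∃[ i ] 2 * n ≤ℕ total (removeAt ks i)
drop-loop {n} (k ∷ ks) lt with 2 * n ≤? total ks
... | yes le = zero , le
... | no ¬le with i , le ← small-loop ks (≰⇒> ¬le) = suc i , +-cancelˡ-≤ 1 _ _ (begin
  suc (2 * n)                                  ≤⟨ lt ⟩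
  total (k ∷ ks)                               ≡⟨ total-removeAt (k ∷ ks) (suc i) ⟩
  lookup ks i + total (removeAt (k ∷ ks) (suc i)) ≤⟨ +-monoˡ-≤ _ le ⟩
  1 + total (removeAt (k ∷ ks) (suc i))        ∎)
  where open ≤-Reasoning

-- The hypothesis says that the controlled value is at least 2. By `drop-loop` some loop can be
-- opened such that the rest has `g` at least 2, where `φ` subtracts exactly 2, and the lower bound
-- is attained by induction.
g-controlled : ∀ (ks : Vec ℕ (suc n)) → 2 * suc n < 2 + total ks → g ks + 2 * suc n ≡ 2 + total ks
g-controlled {zero} (k ∷ []) lt = ≤-antisym (begin
  g (k ∷ []) + 2       ≤⟨ +-monoˡ-≤ 2 (g-≤ (k ∷ []) zero) ⟩
  k + 0 + 2            ≡⟨ +-comm (k + 0) 2 ⟩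
  2 + (k + 0)          ∎) (g-lower (k ∷ []))
  where open ≤-Reasoning
g-controlled {suc n} ks lt
  with i , le ← drop-loop ks (+-cancelˡ-< 2 _ _ (subst (_< 2 + total ks) (*-suc 2 (suc n)) lt))
  = ≤-antisym at-most (g-lower ks)
  where
  open ≤-Reasoning
  ks′ = removeAt ks i

  eq : g ks′ + 2 * suc n ≡ 2 + total ks′
  eq = g-controlled ks′ (s≤s (≤-trans le (n≤1+n _)))

  2≤g : 2 ≤ℕ g ks′
  2≤g = +-cancelʳ-≤ (2 * suc n) 2 (g ks′) (≤-trans (s≤s (s≤s le)) (≤-reflexive (sym eq)))

  φ-big : ∀ {x} → 2 ≤ℕ x → 2 + φ x ≡ x
  φ-big (s≤s (s≤s z≤n)) = refl

  lemma : ∀ k y n → k + y + 2 * suc n ≡ k + (2 + y + 2 * n)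
  lemma = solve-∀

  at-most : g ks + 2 * suc (suc n) ≤ℕ 2 + total ks
  at-most = begin
    g ks + 2 * suc (suc n)                                   ≤⟨ +-monoˡ-≤ _ (g-≤ ks i) ⟩
    lookup ks i + φ (g ks′) + 2 * suc (suc n)                ≡⟨ lemma (lookup ks i) _ (suc n) ⟩
    lookup ks i + (2 + φ (g ks′) + 2 * suc n)                ≡⟨ cong (λ x → lookup ks i + (x + 2 * suc n))
                                                                     (φ-big 2≤g) ⟩
    lookup ks i + (g ks′ + 2 * suc n)                        ≡⟨ cong (λ t → lookup ks i + t) eq ⟩
    lookup ks i + (2 + total ks′)                            ≡⟨ +-comm (lookup ks i) _ ⟩
    2 + (total ks′ + lookup ks i)                            ≡⟨ cong (λ t → 2 + t) (+-comm (total ks′) _) ⟩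
    2 + (lookup ks i + total ks′)                            ≡⟨ cong (λ t → 2 + t) (total-removeAt ks i) ⟨
    2 + total ks                                             ∎

-- 3 + loops with controlled value at most 1

g-h≡1 : ∀ (ks : Vec ℕ n) → h ks ≡ 1 → g ks ≡ 0
g-h≡1 ks eq = n≤0⇒n≡0 (subst (λ x → g ks ≤ℕ χ x) eq (g-≤-χ ks))

χ≡0⇒≡1 : ∀ x → χ x ≡ 0 → x ≡ 1
χ≡0⇒≡1 1 refl = refl

-- Only 4-loops can be opened at no cost at all.
g≡0 : ∀ (ks : Vec ℕ (suc n)) → h ks ≢ 1 → g ks ≡ 0 →
      ∃[ i ] lookup ks i ≡ 0 × φ (g (removeAt ks i)) ≡ 0
g≡0 ks h≢1 eq with g-sel ks
... | inj₁ eq′       = contradiction (χ≡0⇒≡1 _ (trans (sym eq′) eq)) h≢1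
... | inj₂ (i , eq′) = i , m+n≡0⇒m≡0 _ eq″ , m+n≡0⇒n≡0 (lookup ks i) eq″
  where eq″ = trans (sym eq′) eq

removeAt-lookup : ∀ (P : ℕ → Set) (ks : Vec ℕ (suc n)) i → (∀ j → P (lookup ks j)) →
                  ∀ j → P (lookup (removeAt ks i) j)
removeAt-lookup P (k ∷ ks)         zero    p j       = p (suc j)
removeAt-lookup P (k ∷ ks@(_ ∷ _)) (suc i) p zero    = p zero
removeAt-lookup P (k ∷ ks@(_ ∷ _)) (suc i) p (suc j) = removeAt-lookup P ks i (p ∘ suc) j

-- Here the controlled value is 3.
g-excess : ∀ (ks : Vec ℕ n) → 1 + total ks ≡ 2 * n → g ks ≡ 1
g-excess {zero}  [] ()
g-excess {suc n} ks eq = +-cancelʳ-≡ (2 * suc n) _ _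
  (trans (g-controlled ks (s≤s (≤-reflexive (sym eq)))) (cong suc eq))

-- The smallness of the total yields a 6-loop. Opening it attains 1 if `g` of the rest is 1.
-- Otherwise `h` of the rest is 1, whence `h ks` is 2 and opening the chain attains `χ 2 = 1`.
g-no-fours : ∀ (ks : Vec ℕ n) → 2 + total ks ≤ℕ 2 * n → h ks ≢ 1 → (∀ i → lookup ks i ≢ 0) → g ks ≡ 1
g-no-fours {suc n} ks le h≢1 ks≢0 with i , k≤1 ← small-loop ks (≤-trans (n≤1+n _) le)
  = ≤-antisym at-most (n≢0⇒n>0 λ eq → let j , eq′ , _ = g≡0 ks h≢1 eq in ks≢0 j eq′)
  where
  ks′ = removeAt ks i

  k≡1 : lookup ks i ≡ 1
  k≡1 = ≤-antisym k≤1 (n≢0⇒n>0 (ks≢0 i))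

  le′ : 1 + total ks′ ≤ℕ 2 * n
  le′ = +-cancelˡ-≤ 2 _ _ (subst₂ _≤ℕ_
    (cong (λ t → 2 + t) (trans (total-removeAt ks i) (cong (_+ total ks′) k≡1))) (*-suc 2 n) le)

  g≤ : g ks′ ≡ 1 → g ks ≤ℕ 1
  g≤ eq = subst₂ (λ k x → g ks ≤ℕ k + φ x) k≡1 eq (g-≤ ks i)

  2≤h : h ks ≢ 1 → 2 ≤ℕ h ks
  2≤h h≢1 with j , eq ← h-sel ks = ≤∧≢⇒<
    (≤-trans (n≢0⇒n>0 (ks≢0 j)) (≤-trans (m≤m+n _ _) (≤-reflexive (sym eq)))) (≢-sym h≢1)

  at-most : g ks ≤ℕ 1
  at-most with 2 + total ks′ ≤? 2 * n
  ... | no ¬le = g≤ (g-excess ks′ (≤-antisym le′ (≤-pred (≰⇒> ¬le))))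
  ... | yes le″ with h ks′ ≟ 1
  ...   | no  h′≢1 = g≤ (g-no-fours ks′ le″ h′≢1 (removeAt-lookup (_≢ 0) ks i ks≢0))
  ...   | yes h′≡1 = subst (λ x → g ks ≤ℕ χ x) (≤-antisym h≤2 (2≤h h≢1)) (g-≤-χ ks)
    where
    h≤2 : h ks ≤ℕ 2
    h≤2 = subst₂ (λ k x → h ks ≤ℕ k + ψ x) k≡1 h′≡1 (h-≤ ks i)

total-four : ∀ (ks : Vec ℕ (suc n)) i → lookup ks i ≡ 0 → total ks ≡ total (removeAt ks i)
total-four ks i eq = trans (total-removeAt ks i) (cong (_+ total (removeAt ks i)) eq)

-- Removing a 4-loop raises the controlled value by 4, so `g-controlled` applies before and after.
g-controlled-4 : ∀ (ks : Vec ℕ (suc n)) i → 2 * suc n < 2 + total ks → lookup ks i ≡ 0 →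
                 g (removeAt ks i) ≡ 2 + g ks
g-controlled-4 {zero}  (.0 ∷ []) zero lt refl = contradiction lt (<-irrefl refl)
g-controlled-4 {suc n} ks        i    lt eq   = +-cancelʳ-≡ (2 * suc n) _ _ (begin
  g (removeAt ks i) + 2 * suc n   ≡⟨ g-controlled (removeAt ks i) lt′ ⟩
  2 + total (removeAt ks i)       ≡⟨ cong (λ t → 2 + t) (total-four ks i eq) ⟨
  2 + total ks                    ≡⟨ g-controlled ks lt ⟨
  g ks + 2 * suc (suc n)          ≡⟨ lemma (g ks) (suc n) ⟩
  2 + g ks + 2 * suc n            ∎)
  where
  open ≡-Reasoning
  lemma : ∀ x n → x + 2 * suc n ≡ 2 + x + 2 * n
  lemma = solve-∀
  lt′ : 2 * suc n < 2 + total (removeAt ks i)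
  lt′ = <-trans (*-monoʳ-< 2 (n<1+n (suc n)))
    (subst (λ t → 2 * suc (suc n) < 2 + t) (total-four ks i eq) lt)

four? : ∀ (ks : Vec ℕ n) → (∃[ i ] lookup ks i ≡ 0) ⊎ (∀ i → lookup ks i ≢ 0)
four? ks with Fin.any? (λ i → lookup ks i ≟ 0)
... | yes p = inj₁ p
... | no ¬p = inj₂ λ i eq → ¬p (i , eq)

φ≤1 : ∀ {x} → x ≤ℕ 2 → φ x ≤ℕ 1
φ≤1 z≤n             = s≤s z≤n
φ≤1 (s≤s z≤n)       = z≤n
φ≤1 (s≤s (s≤s z≤n)) = z≤n

-- Either the rest still has controlled value at most 1, where the last argument supplies the
-- induction hypothesis, or it is controlled, with value at most 5.
g-step-4 : ∀ (ks : Vec ℕ (suc n)) i → 2 + total ks ≤ℕ 2 * suc n → lookup ks i ≡ 0 →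
           (2 + total (removeAt ks i) ≤ℕ 2 * n → g (removeAt ks i) ≤ℕ 1) → g (removeAt ks i) ≤ℕ 2
g-step-4 {zero}  ks i le eq ih = s≤s z≤n
g-step-4 {suc n} ks i le eq ih with 2 + total (removeAt ks i) ≤? 2 * suc n
... | yes le′ = ≤-trans (ih le′) (s≤s z≤n)
... | no ¬le  = +-cancelʳ-≤ (2 * suc n) _ _ (begin
  g (removeAt ks i) + 2 * suc n   ≡⟨ g-controlled (removeAt ks i) (≰⇒> ¬le) ⟩
  2 + total (removeAt ks i)       ≡⟨ cong (λ t → 2 + t) (total-four ks i eq) ⟨
  2 + total ks                    ≤⟨ le ⟩
  2 * suc (suc n)                 ≡⟨ *-suc 2 (suc n) ⟩
  2 + 2 * suc n                   ∎)
  where open ≤-Reasoning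

-- If `h` is 1 the chain is opened; otherwise a 4-loop is opened if there is one, leaving `g` at
-- most 2, where `φ` is at most 1.
g-uncontrolled : ∀ (ks : Vec ℕ n) → 2 + total ks ≤ℕ 2 * n → g ks ≤ℕ 1
g-uncontrolled {suc n} ks le with h ks ≟ 1
... | yes h≡1 = ≤-trans (≤-reflexive (g-h≡1 ks h≡1)) z≤n
... | no  h≢1 with four? ks
...   | inj₁ (i , eq) = ≤-trans (subst (λ k → g ks ≤ℕ k + φ (g (removeAt ks i))) eq (g-≤ ks i))
                                (φ≤1 (g-step-4 ks i le eq (g-uncontrolled (removeAt ks i))))
...   | inj₂ ≢0       = ≤-reflexive (g-no-fours ks le h≢1 ≢0)

-- `ψ` preserves parity, so every option `k + ψ x` has the parity of the total.
h-parity : ∀ (ks : Vec ℕ n) → 2 ∣ h ks + total ks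
h-parity {zero}  [] = 2 ∣0
h-parity {suc n} ks with i , eq ← h-sel ks rewrite eq | total-removeAt ks i =
  subst (2 ∣_) (lemma (lookup ks i) _ _)
    (∣m∣n⇒∣m+n (m∣m*n (lookup ks i)) (ψ-parity (h (removeAt ks i)) (h-parity (removeAt ks i))))
  where
  lemma : ∀ k x t → 2 * k + (x + t) ≡ k + x + (k + t)
  lemma = solve-∀

  ψ-parity : ∀ x {t} → 2 ∣ x + t → 2 ∣ ψ x + t
  ψ-parity 0             p = ∣m∣n⇒∣m+n ∣-refl p
  ψ-parity 1             p = p
  ψ-parity (suc (suc x)) p = ∣m+n∣m⇒∣n p ∣-refl

-- Opening the 4-loop shows `h ks` to be at most `ψ 1 = 1`, and 0 is excluded because a 4-loop does
-- not change the parity of the total.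
h-four : ∀ (ks : Vec ℕ (suc n)) i → lookup ks i ≡ 0 → h (removeAt ks i) ≡ 1 → h ks ≡ 1
h-four ks i eq h′≡1 with h ks in h≡ | subst₂ (λ k x → h ks ≤ℕ k + ψ x) eq h′≡1 (h-≤ ks i)
... | 0 | _ = contradiction (∣1⇒≡1 (∣m+n∣m⇒∣n (subst (2 ∣_) lemma (h-parity (removeAt ks i))) 2∣t)) λ ()
  where
  2∣t : 2 ∣ total ks
  2∣t = subst (λ x → 2 ∣ x + total ks) h≡ (h-parity ks)
  lemma : h (removeAt ks i) + total (removeAt ks i) ≡ total ks + 1
  lemma = trans (cong₂ _+_ h′≡1 (sym (total-four ks i eq))) (+-comm 1 (total ks))
... | suc zero | _ = refl
... | suc (suc _) | s≤s ()

-- Opening all 4-loops first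

iterate-φ : ℕ → ℕ → ℕ
iterate-φ x zero    = x
iterate-φ x (suc f) = φ (iterate-φ x f)

fours : List ℕ → ℕ
fours = length ∘ filter (_≟ 0)

others : List ℕ → List ℕ
others = filter (¬? ∘ (_≟ 0))

-- The result of opening all 4-loops first.
greedyValue : List ℕ → ℕ
greedyValue ks = iterate-φ (g (fromList (others ks))) (fours ks)

fours-removeAt : ∀ (ks : Vec ℕ (suc n)) i → lookup ks i ≡ 0 →
                 fours (toList ks) ≡ suc (fours (toList (removeAt ks i)))
fours-removeAt (.0 ∷ ks)        zero    refl = refl
fours-removeAt (0 ∷ ks@(_ ∷ _))     (suc i) eq = cong suc (fours-removeAt ks i eq)
fours-removeAt (suc _ ∷ ks@(_ ∷ _)) (suc i) eq = fours-removeAt ks i eq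

others-removeAt : ∀ (ks : Vec ℕ (suc n)) i → lookup ks i ≡ 0 →
                  others (toList ks) ≡ others (toList (removeAt ks i))
others-removeAt (.0 ∷ ks)        zero    refl = refl
others-removeAt (0 ∷ ks@(_ ∷ _))     (suc i) eq = others-removeAt ks i eq
others-removeAt (suc k ∷ ks@(_ ∷ _)) (suc i) eq = cong (suc k ∷_) (others-removeAt ks i eq)

greedyValue-four : ∀ (ks : Vec ℕ (suc n)) i → lookup ks i ≡ 0 →
                   greedyValue (toList ks) ≡ φ (greedyValue (toList (removeAt ks i)))
greedyValue-four ks i eq rewrite fours-removeAt ks i eq | others-removeAt ks i eq = refl

all-≢0 : ∀ {n} (ks : Vec ℕ n) → (∀ i → lookup ks i ≢ 0) → All (_≢ 0) (toList ks)
all-≢0 []       ≢0 = []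
all-≢0 (k ∷ ks) ≢0 = ≢0 zero ∷ all-≢0 ks (≢0 ∘ suc)

greedyValue-no-fours : ∀ (ks : Vec ℕ n) → (∀ i → lookup ks i ≢ 0) → greedyValue (toList ks) ≡ g ks
greedyValue-no-fours ks ≢0
  rewrite List.filter-none (_≟ 0) {xs = toList ks} (all-≢0 ks ≢0)
        | List.filter-all (¬? ∘ (_≟ 0)) {xs = toList ks} (all-≢0 ks ≢0) = g-fromList ks
  where
  fromList-toList : ∀ {n} (ks : Vec ℕ n) → _≡_ {A = ∃ (Vec ℕ)} (_ , fromList (toList ks)) (_ , ks)
  fromList-toList []       = refl
  fromList-toList (k ∷ ks) = cong (λ (n , ks) → suc n , k ∷ ks) (fromList-toList ks)

  g-fromList : ∀ {n} (ks : Vec ℕ n) → g (fromList (toList ks)) ≡ g ks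
  g-fromList ks = cong (λ (_ , ks) → g ks) (fromList-toList ks)

-- `greedyValue` does not depend on which 4-loop is removed, so by induction all 4-loops are equally
-- good. If `g` is 0 then some 4-loop attains it, hence so does the chosen one; otherwise `φ` is at
-- most 1 in the uncontrolled case.
g-greedy : ∀ (ks : Vec ℕ n) → h ks ≢ 1 → g ks ≡ greedyValue (toList ks)
g-greedy ks h≢1 with four? ks
... | inj₂ ≢0 = sym (greedyValue-no-fours ks ≢0)
g-greedy {suc n} ks h≢1 | inj₁ (i , eq) =
  trans (≤-antisym (subst (λ k → g ks ≤ℕ k + φ (g ks′)) eq (g-≤ ks i)) φ≤g)
  (trans (cong φ (ih i eq)) (sym (greedyValue-four ks i eq)))
  where
  ks′ = removeAt ks i

  ih : ∀ j → lookup ks j ≡ 0 → g (removeAt ks j) ≡ greedyValue (toList (removeAt ks j))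
  ih j eq = g-greedy (removeAt ks j) (h≢1 ∘ h-four ks j eq)

  g≡g : ∀ j → lookup ks j ≡ 0 → g (removeAt ks j) ≡ g ks′
  g≡g j eq′ = trans (ih j eq′) (trans (cong₂ (λ ks f → iterate-φ (g (fromList ks)) f)
      (trans (sym (others-removeAt ks j eq′)) (others-removeAt ks i eq))
      (suc-injective (trans (sym (fours-removeAt ks j eq′)) (fours-removeAt ks i eq))))
    (sym (ih i eq)))

  φ≤g : φ (g ks′) ≤ℕ g ks
  φ≤g with 2 + total ks ≤? 2 * suc n
  ... | yes le with g ks ≟ 0
  ...   | no  g≢0 = ≤-trans (φ≤1 (g-step-4 ks i le eq (g-uncontrolled ks′))) (n≢0⇒n>0 g≢0)
  ...   | yes g≡0′ with j , eq′ , φ≡0 ← g≡0 ks h≢1 g≡0′ =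
    ≤-trans (≤-reflexive (trans (cong φ (sym (g≡g j eq′))) φ≡0)) z≤n
  -- In the controlled case `g` of the rest is `2 + g ks`, which `φ` takes back to `g ks`.
  φ≤g | no ¬le = ≤-reflexive (cong φ (g-controlled-4 ks i (≰⇒> ¬le) eq))

-- With `d` the residue of `1 + 2 * n` modulo 8, `1 + 2 * bit n` is 4 minus the distance of `d` from
-- 4.
bit : ℕ → ℕ
bit 0                         = 0
bit 1                         = 1
bit 2                         = 1
bit 3                         = 0
bit (suc (suc (suc (suc n)))) = bit n

φ-bit : ∀ n → φ (bit n) ≡ bit (2 + n)
φ-bit 0                         = refl
φ-bit 1                         = refl
φ-bit 2                         = refl
φ-bit 3                         = refl
φ-bit (suc (suc (suc (suc n)))) = φ-bit n

iterate-φ-shift : ∀ x f → iterate-φ (φ x) f ≡ φ (iterate-φ x f)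
iterate-φ-shift x zero    = refl
iterate-φ-shift x (suc f) = cong φ (iterate-φ-shift x f)

-- While `x` is at least 2, a step lowers `x` and `2 * f` by 2 each, hence their sum by 4, the
-- period of `bit`. The hypothesis leaves enough steps to reach 0 or 1, which `φ` then exchanges.
iterate-φ-bit : ∀ x f → x ≤ℕ 1 + 2 * f → iterate-φ x f ≡ bit (x + 2 * f)
iterate-φ-bit 0 zero    _  = refl
iterate-φ-bit 1 zero    _  = refl
iterate-φ-bit 0 (suc f) _  =
  trans (cong φ (iterate-φ-bit 0 f z≤n)) (trans (φ-bit (2 * f)) (cong bit (sym (*-suc 2 f))))
iterate-φ-bit 1 (suc f) _  =
  trans (cong φ (iterate-φ-bit 1 f (s≤s z≤n)))
    (trans (φ-bit (1 + 2 * f)) (cong (bit ∘ suc) (sym (*-suc 2 f))))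
iterate-φ-bit (suc (suc x)) zero (s≤s ())
iterate-φ-bit (suc (suc x)) (suc f) le = begin
  φ (iterate-φ (2 + x) f)       ≡⟨ iterate-φ-shift (2 + x) f ⟨
  iterate-φ x f                 ≡⟨ iterate-φ-bit x f le′ ⟩
  bit (x + 2 * f)               ≡⟨ cong bit (lemma x f) ⟨
  bit (2 + x + 2 * suc f)       ∎
  where
  open ≡-Reasoning
  le′ : x ≤ℕ 1 + 2 * f
  le′ = +-cancelˡ-≤ 2 _ _ (subst (λ y → 2 + x ≤ℕ 1 + y) (*-suc 2 f) le)
  lemma : ∀ x f → 2 + x + 2 * suc f ≡ 4 + (x + 2 * f)
  lemma = solve-∀

length-fours-others : ∀ ks → length ks ≡ length (others ks) + fours ks
length-fours-others []           = refl
length-fours-others (zero ∷ ks)  = trans (cong suc (length-fours-others ks)) (sym (+-suc _ (fours ks)))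
length-fours-others (suc k ∷ ks) = cong suc (length-fours-others ks)

sum-others : ∀ ks → sum ks ≡ sum (others ks)
sum-others []           = refl
sum-others (zero ∷ ks)  = sum-others ks
sum-others (suc k ∷ ks) = cong (λ t → suc k + t) (sum-others ks)

-- Removing the 4-loops raises the controlled value by 4 for each. If the rest is controlled, its
-- `g` is at most `2 * fours ks`; otherwise, or if only the chain is left, `g` is at most 1.
g-others-≤ : ∀ ks → 2 + sum ks ≤ℕ 2 * length ks → g (fromList (others ks)) ≤ℕ 1 + 2 * fours ks
g-others-≤ ks le = bound (others ks) (sum-others ks) (length-fours-others ks)
  where
  open ≤-Reasoning
  lemma : ∀ n f → 2 * (n + f) ≡ 2 * f + 2 * n
  lemma = solve-∀

  bound : ∀ js → sum ks ≡ sum js → length ks ≡ length js + fours ks → g (fromList js) ≤ℕ 1 + 2 * fours ks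
  bound []         _ _ = s≤s z≤n
  bound js@(_ ∷ _) s l with 2 + total (fromList js) ≤? 2 * length js
  ... | yes le′ = ≤-trans (g-uncontrolled (fromList js) le′) (s≤s z≤n)
  ... | no ¬le  = ≤-trans (+-cancelʳ-≤ (2 * length js) _ _ (begin
    g (fromList js) + 2 * length js   ≡⟨ g-controlled (fromList js) (≰⇒> ¬le) ⟩
    2 + total (fromList js)           ≡⟨ cong (λ l → 2 + sum l) (Vec.toList∘fromList js) ⟩
    2 + sum js                        ≡⟨ cong (λ t → 2 + t) s ⟨
    2 + sum ks                        ≤⟨ le ⟩
    2 * length ks                     ≡⟨ cong (2 *_) l ⟩
    2 * (length js + fours ks)        ≡⟨ lemma (length js) (fours ks) ⟩
    2 * fours ks + 2 * length js      ∎)) (n≤1+n _)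

-- Solving loops and 3 + loops

loopShape : ℕ → Shape
loopShape k = O (2 + 2 * k)

loopShapes : List ℕ → List Shape
loopShapes = List.map loopShape

loopShapes-removeAt : ∀ (ks : Vec ℕ (suc n)) i →
  loopShapes (toList ks) ↭ loopShape (lookup ks i) ∷ loopShapes (toList (removeAt ks i))
loopShapes-removeAt ks i = map⁺ loopShape (removeAt-↭ ks i)

loopShapes-↭ : ∀ (ks : Vec ℕ (suc n)) {s Q} → loopShapes (toList ks) ↭ s ∷ Q →
  ∃[ i ] s ≡ loopShape (lookup ks i) × Q ↭ loopShapes (toList (removeAt ks i))
loopShapes-↭ ks π with _ , k∈ , refl ← ∈-map⁻ loopShape (∈-resp-↭ (↭-sym π) (here refl))
  with i , refl ← ∈-toList⁻ ks k∈ = i , refl , drop-∷ (↭-trans (↭-sym π) (loopShapes-removeAt ks i))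

loopShapes-closed : ∀ ks → All Closed (loopShapes ks)
loopShapes-closed []       = []
loopShapes-closed (k ∷ ks) = O (2 * k) ∷ loopShapes-closed ks

cost-ψ : ∀ k x (c : Closed (loopShape k)) → cost c (+ (2 * x)) ≡ + (2 * (k + ψ x))
cost-ψ k x (O .(2 * k)) = cong +_ (trans (cong (λ d → 2 * k + d) (eq x)) (sym (*-distribˡ-+ 2 k (ψ x))))
  where
  eq : ∀ x → ∣ + (2 * x) - + 4 ∣ ≡ 2 * ψ x
  eq 0             = refl
  eq 1             = refl
  eq (suc (suc x)) = cong (λ y → ∣ + y - + 4 ∣) (*-distribˡ-+ 2 2 x)

cost-φ : ∀ k x (c : Closed (loopShape k)) → cost c (+ (1 + 2 * x)) ≡ + (1 + 2 * (k + φ x))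
cost-φ k x (O .(2 * k)) = cong +_ (trans (cong (λ d → 2 * k + d) (eq x)) (lemma k (φ x)))
  where
  eq : ∀ x → ∣ + (1 + 2 * x) - + 4 ∣ ≡ 1 + 2 * φ x
  eq 0             = refl
  eq 1             = refl
  eq (suc (suc x)) = cong (λ y → ∣ + suc y - + 4 ∣) (*-distribˡ-+ 2 2 x)

  lemma : ∀ k y → 2 * k + (1 + 2 * y) ≡ 1 + 2 * (k + y)
  lemma = solve-∀

cost-χ : ∀ x (c : Closed (C 2)) → cost c (+ (2 * x)) ≡ + (1 + 2 * χ x)
cost-χ x (C 0) = cong (λ d → + (1 + d)) (eq x)
  where
  eq : ∀ x → ∣ + (2 * x) - + 2 ∣ ≡ 2 * χ x
  eq 0       = refl
  eq (suc x) = cong (λ y → ∣ + y - + 2 ∣) (*-suc 2 x)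

double-mono : m ≤ℕ n → + (2 * m) ≤ + (2 * n)
double-mono le = ℤ.+≤+ (*-monoʳ-≤ 2 le)

suc-double-mono : m ≤ℕ n → + (1 + 2 * m) ≤ + (1 + 2 * n)
suc-double-mono le = ℤ.+≤+ (s≤s (*-monoʳ-≤ 2 le))

solved-loops : ∀ (ks : Vec ℕ n) → Solved (loopShapes (toList ks)) (+ (2 * h ks))
solved-loops []          = solved-[]
solved-loops ks@(_ ∷ _) with i , eq ← h-sel ks = solved-∷ (loopShapes-closed (toList ks))
  ( loopShape (lookup ks i) , loopShapes (toList (removeAt ks i)) , _ , loopShapes-removeAt ks i
  , solved-loops (removeAt ks i)
  , λ c → ℤ.≤-reflexive (trans (cost-ψ (lookup ks i) (h (removeAt ks i)) c) (cong (λ x → + (2 * x)) (sym eq))))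
  λ π → let j , s≡ , τ = loopShapes-↭ ks π in
    _ , solved-resp-↭ (↭-sym τ) (solved-loops (removeAt ks j)) , below j s≡
  where
  below : ∀ j {s} → s ≡ loopShape (lookup ks j) → (c : Closed s) →
          + (2 * h ks) ≤ cost c (+ (2 * h (removeAt ks j)))
  below j refl c = ℤ.≤-trans (double-mono (h-≤ ks j))
    (ℤ.≤-reflexive (sym (cost-ψ (lookup ks j) (h (removeAt ks j)) c)))

solved-3+loops : ∀ (ks : Vec ℕ n) → Solved (C 2 ∷ loopShapes (toList ks)) (+ (1 + 2 * g ks))
solved-3+loops {n} ks = solved-∷ (C 0 ∷ loopShapes-closed (toList ks)) (best ks) (all ks)
  where
  Best All′ : ∀ {n} → Vec ℕ n → Set
  Best ks = ∃[ s ] ∃[ Q ] ∃[ y ] C 2 ∷ loopShapes (toList ks) ↭ s ∷ Q × Solved Q y ×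
            (∀ (c : Closed s) → cost c y ≤ + (1 + 2 * g ks))
  All′ ks = ∀ {s Q} → C 2 ∷ loopShapes (toList ks) ↭ s ∷ Q →
            ∃[ y ] Solved Q y × (∀ (c : Closed s) → + (1 + 2 * g ks) ≤ cost c y)

  take-chain : ∀ {n} (ks : Vec ℕ n) → g ks ≡ χ (h ks) → Best ks
  take-chain ks eq = _ , _ , _ , refl , solved-loops ks ,
    λ c → ℤ.≤-reflexive (trans (cost-χ (h ks) c) (cong (λ x → + (1 + 2 * x)) (sym eq)))

  best : ∀ {n} (ks : Vec ℕ n) → Best ks
  best []         = take-chain [] refl
  best ks@(_ ∷ _) with g-sel ks
  ... | inj₁ eq       = take-chain ks eq
  ... | inj₂ (i , eq) = _ , _ , _ , ↭-trans (prep _ (loopShapes-removeAt ks i)) (swap _ _ refl) ,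
    solved-3+loops (removeAt ks i) ,
    λ c → ℤ.≤-reflexive (trans (cost-φ (lookup ks i) (g (removeAt ks i)) c)
                               (cong (λ x → + (1 + 2 * x)) (sym eq)))

  below-χ : ∀ {n} (ks : Vec ℕ n) {s} → s ≡ C 2 → (c : Closed s) →
            + (1 + 2 * g ks) ≤ cost c (+ (2 * h ks))
  below-χ ks refl c = ℤ.≤-trans (suc-double-mono (g-≤-χ ks)) (ℤ.≤-reflexive (sym (cost-χ (h ks) c)))

  below-φ : ∀ {n} (ks : Vec ℕ (suc n)) j {s} → s ≡ loopShape (lookup ks j) → (c : Closed s) →
            + (1 + 2 * g ks) ≤ cost c (+ (1 + 2 * g (removeAt ks j)))
  below-φ ks j refl c = ℤ.≤-trans (suc-double-mono (g-≤ ks j))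
    (ℤ.≤-reflexive (sym (cost-φ (lookup ks j) (g (removeAt ks j)) c)))

  all : ∀ {n} (ks : Vec ℕ n) → All′ ks
  all ks π with ++-↭-∷ (C 2 ∷ []) π
  all ks π | inj₁ (S′ , σ , τ) with s≡ , refl ← singleton-≡ σ =
    _ , solved-resp-↭ (↭-sym τ) (solved-loops ks) , below-χ ks s≡
  all []         π | inj₂ (E′ , σ , τ) with () ← ↭-length σ
  all ks@(_ ∷ _) π | inj₂ (E′ , σ , τ) with j , s≡ , ρ ← loopShapes-↭ ks σ =
    _ , solved-resp-↭ (↭-sym (↭-trans τ (prep _ ρ))) (solved-3+loops (removeAt ks j)) , below-φ ks j s≡

-- Chains and loops as positions

links-tabulate : ∀ (f : Fin (suc n) → X) →
  links (f zero) (List.tabulate (f ∘ suc)) ≡ List.tabulate (λ i → f (inject₁ i) , f (suc i))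
links-tabulate {n = zero}  f = refl
links-tabulate {n = suc n} f = cong (_ ∷_) (links-tabulate (f ∘ suc))

lastOf-tabulate : ∀ (f : Fin (suc n) → X) → lastOf (f zero) (List.tabulate (f ∘ suc)) ≡ f (fromℕ n)
lastOf-tabulate {n = zero}  f = refl
lastOf-tabulate {n = suc n} f = lastOf-tabulate (f ∘ suc)

edges-path : ∀ n → edges (path n) ≡ links zero (List.tabulate suc)
edges-path n = trans (cong (List.map edge) (toList-tabulate _))
  (trans (List.map-tabulate _ edge) (sym (links-tabulate {n = n} id)))

rep-chain : ∀ n → Rep (chainLines n) (C n ∷ [])
rep-chain n = rep {pieces = row true zero (List.tabulate suc) true ∷ []}
  (layout (↭-reflexive (List.++-identityʳ _))
          (↭-reflexive (trans (cong₂ (λ x es → (zero , zero) ∷ (x , x) ∷ es)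
                                     (sym (lastOf-tabulate id)) (edges-path n))
                              (sym (List.++-identityʳ _)))))
  (↭-reflexive (cong (λ n → C n ∷ []) (List.length-tabulate suc)))

rep-loop : ∀ n → Rep (loopLines n) (O n ∷ [])
rep-loop n = rep {pieces = cyc zero (List.tabulate suc) ∷ []}
  (layout (↭-reflexive (List.++-identityʳ _))
          (↭-reflexive (trans (cong₂ (λ x es → (x , zero) ∷ es)
                                     (sym (lastOf-tabulate id)) (edges-path (suc n)))
                              (sym (List.++-identityʳ _)))))
  (↭-reflexive (cong (λ n → O n ∷ []) (List.length-tabulate (Fin.suc ∘ suc))))

mapPiece : (Fin m → Fin n) → Piece m → Piece n
mapPiece f (row l x xs r) = row l (f x) (List.map f xs) r
mapPiece f (cyc x xs)     = cyc (f x) (List.map f xs)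

module _ (f : Fin m → Fin n) where

  mapPiece-boxes : ∀ ps → concatMap boxesOf (List.map (mapPiece f) ps) ≡ List.map f (concatMap boxesOf ps)
  mapPiece-boxes ps = begin
    concatMap boxesOf (List.map (mapPiece f) ps)      ≡⟨ List.concatMap-map boxesOf (mapPiece f) ps ⟩
    concatMap (boxesOf ∘ mapPiece f) ps               ≡⟨ List.concatMap-cong boxesOf-map ps ⟩
    concatMap (List.map f ∘ boxesOf) ps               ≡⟨ List.map-concatMap f boxesOf ps ⟨
    List.map f (concatMap boxesOf ps)                 ∎
    where
    open ≡-Reasoning
    boxesOf-map : ∀ p → boxesOf (mapPiece f p) ≡ List.map f (boxesOf p)
    boxesOf-map (row _ _ _ _) = refl
    boxesOf-map (cyc _ _)     = refl

  private
    f² = Product.map f f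

    links-map : ∀ x xs → links (f x) (List.map f xs) ≡ List.map f² (links x xs)
    links-map x []       = refl
    links-map x (y ∷ ys) = cong (_ ∷_) (links-map y ys)

    lastOf-map : ∀ x xs → lastOf (f x) (List.map f xs) ≡ f (lastOf x xs)
    lastOf-map x []       = refl
    lastOf-map x (y ∷ ys) = lastOf-map y ys

    end-map : ∀ l x → end l (f x) ≡ List.map f² (end l x)
    end-map true  x = refl
    end-map false x = refl

    edgesOf-map : ∀ p → edgesOf (mapPiece f p) ≡ List.map f² (edgesOf p)
    edgesOf-map (row l x xs r)
      rewrite lastOf-map x xs | end-map l x | end-map r (lastOf x xs) | links-map x xs
      = sym (trans (List.map-++ f² (end l x) _) (cong (_ ++_) (List.map-++ f² (end r (lastOf x xs)) _)))
    edgesOf-map (cyc x xs) = cong₂ _∷_ (cong (_, f x) (lastOf-map x xs)) (links-map x xs)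

  mapPiece-edges : ∀ ps → concatMap edgesOf (List.map (mapPiece f) ps) ≡ List.map f² (concatMap edgesOf ps)
  mapPiece-edges ps = begin
    concatMap edgesOf (List.map (mapPiece f) ps)      ≡⟨ List.concatMap-map edgesOf (mapPiece f) ps ⟩
    concatMap (edgesOf ∘ mapPiece f) ps               ≡⟨ List.concatMap-cong edgesOf-map ps ⟩
    concatMap (List.map f² ∘ edgesOf) ps              ≡⟨ List.map-concatMap f² edgesOf ps ⟨
    List.map f² (concatMap edgesOf ps)                ∎
    where open ≡-Reasoning

  mapPiece-shapes : ∀ ps → shapes (List.map (mapPiece f) ps) ≡ shapes ps
  mapPiece-shapes ps = trans (List.mapMaybe-map shape (mapPiece f) ps) (List.mapMaybe-cong shape-map ps)
    where
    shape-map : ∀ p → shape (mapPiece f p) ≡ shape p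
    shape-map (row true  x xs true)       rewrite List.length-map f xs = refl
    shape-map (row true  x xs false)      rewrite List.length-map f xs = refl
    shape-map (row false x xs true)       rewrite List.length-map f xs = refl
    shape-map (row false x [] false)      = refl
    shape-map (row false x (y ∷ ys) false) rewrite List.length-map f ys = refl
    shape-map (cyc x [])                  = refl
    shape-map (cyc x (y ∷ ys))            rewrite List.length-map f ys = refl

  edges-relabel : ∀ (f-inj : ∀ {x y} → f x ≡ f y → x ≡ y) (ls : Vec (Line m) k) →
                  edges (Vec.map (relabel f f-inj) ls) ≡ List.map f² (edges ls)
  edges-relabel f-inj []                 = refl
  edges-relabel f-inj (outer _ ∷ ls)     = cong (_ ∷_) (edges-relabel f-inj ls)
  edges-relabel f-inj (inner _ _ _ ∷ ls) = cong (_ ∷_) (edges-relabel f-inj ls)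

tabulate-+ : ∀ m (f : Fin (m + n) → X) →
             List.tabulate f ≡ List.tabulate (λ i → f (i ↑ˡ n)) ++ List.tabulate (λ j → f (m ↑ʳ j))
tabulate-+ zero    f = refl
tabulate-+ (suc m) f = cong (_ ∷_) (tabulate-+ m (f ∘ suc))

-- The boxes and edges of the union are the images of both sides under the two injections, and
-- relabelling keeps the shape of a piece.
rep-⊕ : ∀ G H {P Q} → Rep (lines G) P → Rep (lines H) Q → Rep (lines (G ⊕ H)) (P ++ Q)
rep-⊕ G H (rep {pieces = ps} (layout bs es) σ) (rep {pieces = qs} (layout bs′ es′) σ′) =
  rep {pieces = List.map (mapPiece l) ps ++ List.map (mapPiece r) qs}
    (layout
      (↭-trans (↭-reflexive (trans (List.concatMap-++ boxesOf (List.map (mapPiece l) ps) _)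
                                   (cong₂ _++_ (mapPiece-boxes l ps) (mapPiece-boxes r qs))))
        (↭-trans (++⁺ (map⁺ l bs) (map⁺ r bs′))
          (↭-reflexive (sym (trans (tabulate-+ (boxes G) id)
            (cong₂ _++_ (sym (List.map-tabulate id l)) (sym (List.map-tabulate id r))))))))
      (↭-trans (↭-reflexive (trans (cong (List.map edge) (Vec.toList-++ (Vec.map _ (lines G)) _))
                              (trans (List.map-++ edge (toList (Vec.map _ (lines G))) _)
                                (cong₂ _++_ (edges-relabel l _ (lines G)) (edges-relabel r _ (lines H))))))
        (↭-trans (++⁺ (map⁺ (Product.map l l) es) (map⁺ (Product.map r r) es′))
          (↭-reflexive (sym (trans (List.concatMap-++ edgesOf (List.map (mapPiece l) ps) _)
                                   (cong₂ _++_ (mapPiece-edges l ps) (mapPiece-edges r qs))))))))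
    (↭-trans (↭-reflexive (trans (List.mapMaybe-++ shape (List.map (mapPiece l) ps) _)
                                 (cong₂ _++_ (mapPiece-shapes l ps) (mapPiece-shapes r qs))))
      (++⁺ σ σ′))
  where
  l = _↑ˡ boxes H
  r = boxes G ↑ʳ_

-- A length `q * 2` is `4 + 2 * (q - 2)`; the subtraction does not truncate, since the length is at
-- least 4.
half : Loop → ℕ
half (mkLoop _ _ (divides q _)) = q ∸ 2

loop-length : ∀ ℓ → Loop.length ℓ ≡ 4 + 2 * half ℓ
loop-length (mkLoop .0 () (divides 0 refl))
loop-length (mkLoop .2 (s≤s (s≤s ())) (divides 1 refl))
loop-length (mkLoop .(suc (suc q) * 2) _ (divides (suc (suc q)) refl)) = cong (λ k → 4 + k) (*-comm q 2)

rep-loopGame : ∀ ℓ → Rep (lines (loopGame ℓ)) (loopShape (half ℓ) ∷ [])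
rep-loopGame ℓ@(mkLoop (suc (suc n)) _ _) =
  subst (λ m → Rep (loopLines n) (O m ∷ [])) (suc-injective (suc-injective (loop-length ℓ))) (rep-loop n)
rep-loopGame (mkLoop 1 (s≤s ()) _)

rep-loops : ∀ ls → Rep (lines (⨁ (List.map loopGame ls))) (loopShapes (List.map half ls))
rep-loops []       = rep {pieces = []} (layout refl refl) refl
rep-loops (ℓ ∷ ls) = rep-⊕ (loopGame ℓ) (⨁ (List.map loopGame ls)) (rep-loopGame ℓ) (rep-loops ls)

solved-value : ∀ {E x} {ls : Vec (Line b) k} → Solved E x → Rep ls E → value ls ≡ x
solved-value sol R = ℤ.≤-antisym (Solved.upper sol _ R) (Solved.lower sol _ R)

v-loops : ∀ ls → v ⟦ endgame [] ls ⟧ ≡ + (2 * h (fromList (List.map half ls)))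
v-loops ls = solved-value (solved-loops (fromList (List.map half ls)))
  (subst (λ ks → Rep (lines ⟦ endgame [] ls ⟧) (loopShapes ks)) (sym (Vec.toList∘fromList _)) (rep-loops ls))

v-3+loops : ∀ ls → v ⟦ three+ endgame [] ls ⟧ ≡ + (1 + 2 * g (fromList (List.map half ls)))
v-3+loops ls = solved-value (solved-3+loops (fromList (List.map half ls)))
  (subst (λ ks → Rep (lines ⟦ three+ endgame [] ls ⟧) (C 2 ∷ loopShapes ks)) (sym (Vec.toList∘fromList _))
    (rep-⊕ (chain 3) (⨁ (List.map loopGame ls)) (rep-chain 2) (rep-loops ls)))

fours-half : ∀ ls → length (filter fourLoop? ls) ≡ fours (List.map half ls)
fours-half []                                               = refl
fours-half (mkLoop _ () (divides 0 refl) ∷ _)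
fours-half (mkLoop _ (s≤s (s≤s ())) (divides 1 refl) ∷ _)
fours-half (mkLoop _ _ (divides 2 refl) ∷ ls)                   = cong suc (fours-half ls)
fours-half (mkLoop _ _ (divides (suc (suc (suc _))) refl) ∷ ls) = fours-half ls

others-half : ∀ ls → List.map half (filter (¬? ∘ fourLoop?) ls) ≡ others (List.map half ls)
others-half []                                               = refl
others-half (mkLoop _ () (divides 0 refl) ∷ _)
others-half (mkLoop _ (s≤s (s≤s ())) (divides 1 refl) ∷ _)
others-half (mkLoop _ _ (divides 2 refl) ∷ ls)                   = others-half ls
others-half (mkLoop _ _ (divides (suc (suc (suc q))) refl) ∷ ls) = cong (suc q ∷_) (others-half ls)

-- Adding 4 for each loop turns its contribution `(4 + 2 * k) - 8` into the natural number `2 * k`.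
sum-fcv : ∀ ls → sumℤ (List.map (λ ℓ → + Loop.length ℓ - + 8) ls) ℤ.+ + (4 * length (List.map half ls))
               ≡ + (2 * sum (List.map half ls))
sum-fcv []       = refl
sum-fcv (ℓ ∷ ls) = begin
  (+ Loop.length ℓ - + 8) ℤ.+ F ℤ.+ + (4 * suc L)        ≡⟨ cong₂ (λ a b → (+ a - + 8) ℤ.+ F ℤ.+ + b)
                                                                  (loop-length ℓ) (*-suc 4 L) ⟩
  (+ (4 + 2 * half ℓ) - + 8) ℤ.+ F ℤ.+ + (4 + 4 * L)    ≡⟨ lemma (+ (2 * half ℓ)) F (+ (4 * L)) ⟩
  + (2 * half ℓ) ℤ.+ (F ℤ.+ + (4 * L))                  ≡⟨ cong (λ a → + (2 * half ℓ) ℤ.+ a) (sum-fcv ls) ⟩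
  + (2 * half ℓ + 2 * sum (List.map half ls))            ≡⟨ cong +_ (*-distribˡ-+ 2 (half ℓ) _) ⟨
  + (2 * (half ℓ + sum (List.map half ls)))              ∎
  where
  open ≡-Reasoning
  L = length (List.map half ls)
  F = sumℤ (List.map (λ ℓ → + Loop.length ℓ - + 8) ls)
  lemma : ∀ k s n → (+ 4 ℤ.+ k - + 8) ℤ.+ s ℤ.+ (+ 4 ℤ.+ n) ≡ k ℤ.+ (s ℤ.+ n)
  lemma = ℤRing.solve-∀

-- The 5 is `3 - 4` from the chain plus the terminal bonus 6, which presupposes a loop.
cv-3+loops : ∀ ls → ls ≢ [] → cv (three+ endgame [] ls) ℤ.+ + (4 * length (List.map half ls))
                            ≡ + (5 + 2 * sum (List.map half ls))
cv-3+loops []           ls≢[] = contradiction refl ls≢[]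
cv-3+loops ls@(_ ∷ _)   _     =
  trans (lemma F (+ (4 * length (List.map half ls)))) (cong (λ a → + 5 ℤ.+ a) (sum-fcv ls))
  where
  F = sumℤ (List.map (λ ℓ → + Loop.length ℓ - + 8) ls)
  lemma : ∀ s n → ((+ 3 - + 4) ℤ.+ + 0) ℤ.+ s ℤ.+ + 6 ℤ.+ n ≡ + 5 ℤ.+ (s ℤ.+ n)
  lemma = ℤRing.solve-∀

-- Residues modulo 8

bit-+4* : ∀ n m → bit (n + 4 * m) ≡ bit n
bit-+4* n zero    = cong bit (+-identityʳ n)
bit-+4* n (suc m) = trans (cong bit (lemma n m)) (bit-+4* n m)
  where
  lemma : ∀ n m → n + 4 * suc m ≡ 4 + (n + 4 * m)
  lemma = solve-∀

%8-period : ∀ x → (1 + 2 * (4 + x)) % 8 ≡ (1 + 2 * x) % 8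
%8-period x = trans (cong (_% 8) (lemma x)) ([m+n]%n≡m%n (1 + 2 * x) 8)
  where
  lemma : ∀ x → 1 + 2 * (4 + x) ≡ 1 + 2 * x + 8
  lemma = solve-∀

-- Both sides have period 4 in `x`. The shift by 2 is the effect of an odd number of 4-loops.
bit-odd : ∀ x → + (1 + 2 * bit (2 + x)) ≡ + ∣ + 4 - + ((1 + 2 * x) % 8) ∣
bit-odd 0 = refl
bit-odd 1 = refl
bit-odd 2 = refl
bit-odd 3 = refl
bit-odd (suc (suc (suc (suc x)))) = trans (bit-odd x) (cong (λ d → + ∣ + 4 - + d ∣) (sym (%8-period x)))

bit-even : ∀ x → + (1 + 2 * bit x) ≡ + 4 - + ∣ + 4 - + ((1 + 2 * x) % 8) ∣
bit-even 0 = refl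
bit-even 1 = refl
bit-even 2 = refl
bit-even 3 = refl
bit-even (suc (suc (suc (suc x)))) = trans (bit-even x) (cong (λ d → + 4 - + ∣ + 4 - + d ∣) (sym (%8-period x)))

odd : ∀ f → ¬ (2 ∣ f) → ∃[ m ] f ≡ 1 + m * 2
odd 0             ¬2∣f = contradiction (divides 0 refl) ¬2∣f
odd 1             ¬2∣f = 0 , refl
odd (suc (suc f)) ¬2∣f
  with m , refl ← odd f (λ { (divides q refl) → ¬2∣f (divides (suc q) refl) }) = suc m , refl

no-fours : ∀ (ks : Vec ℕ n) → fours (toList ks) ≡ 0 → ∀ i → lookup ks i ≢ 0
no-fours ks@(_ ∷ _) f≡0 i eq with () ← trans (sym f≡0) (fours-removeAt ks i eq)

corollary24 :
    (H : SimpleLoonyEndgame) → chains H ≡ [] → loops H ≢ [] →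
    let G = three+ H
        f = #fourLoops H
        c = cv G
        M = withoutFourLoops G
        d = v ⟦ M ⟧ %ℕ 8
    in (+ 2 ≤ c → v ⟦ G ⟧ ≡ c)
     × (c ≤ + 1 → v ⟦ H ⟧ ≡ + 2 → v ⟦ G ⟧ ≡ + 1)
     × (c ≤ + 1 → v ⟦ H ⟧ ≢ + 2 → f ≡ 0 → v ⟦ G ⟧ ≡ + 3)
     × (c ≤ + 1 → v ⟦ H ⟧ ≢ + 2 → 1 ≤ℕ f →
          (¬ (2 ∣ f) → v ⟦ G ⟧ ≡ + ∣ + 4 - + d ∣)
        × (2 ∣ f → v ⟦ G ⟧ ≡ + 4 - + ∣ + 4 - + d ∣))
corollary24 (endgame .[] [])         refl ls≢[] = contradiction refl ls≢[]
corollary24 (endgame .[] ls@(_ ∷ _)) refl ls≢[] = part-a , part-b , part-c , part-d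
  where
  H = endgame [] ls
  G = three+ H
  c = cv G
  ks = List.map half ls
  js = fromList ks
  N = length ks
  f = fours ks

  v-M : v ⟦ withoutFourLoops G ⟧ ≡ + (1 + 2 * g (fromList (others ks)))
  v-M = trans (v-3+loops (filter (¬? ∘ fourLoop?) ls))
    (cong (λ ks → + (1 + 2 * g (fromList ks))) (others-half ls))

  total-js : total js ≡ sum ks
  total-js = cong sum (Vec.toList∘fromList ks)

  c≡ : c ℤ.+ + (4 * N) ≡ + (5 + 2 * sum ks)
  c≡ = cv-3+loops ls ls≢[]

  controlled : + 2 ≤ c → 2 * N < 2 + sum ks
  -- From `2 ≤ c` comes `4 * N ≤ 3 + 2 * sum ks`, which contradicts the double of `le`.
  controlled 2≤c = ≰⇒> λ le → <⇒≱ {4 * N} {4 + 2 * sum ks}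
    (s≤s (≤-pred₂ (ℤ.drop‿+≤+ (subst (+ 2 ℤ.+ + (4 * N) ≤_) c≡ (ℤ.+-monoˡ-≤ (+ (4 * N)) 2≤c)))))
    (subst₂ _≤ℕ_ (*-distribˡ-+ 2 2 (sum ks)) (sym (*-assoc 2 2 N)) (*-monoʳ-≤ 2 le))
    where
    ≤-pred₂ : ∀ {m n} → 2 + m ≤ℕ 2 + n → m ≤ℕ n
    ≤-pred₂ (s≤s (s≤s le)) = le

  uncontrolled : c ≤ + 1 → 2 + sum ks ≤ℕ 2 * N
  -- From `c ≤ 1` comes `5 + 2 * sum ks ≤ 1 + 4 * N`; subtracting 1 and halving gives the claim.
  uncontrolled c≤1 = *-cancelˡ-≤ 2 (subst₂ _≤ℕ_ (sym (*-distribˡ-+ 2 2 (sum ks))) (*-assoc 2 2 N)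
    (≤-pred (ℤ.drop‿+≤+ (subst (_≤ + 1 ℤ.+ + (4 * N)) c≡ (ℤ.+-monoˡ-≤ (+ (4 * N)) c≤1)))))

  h≢1 : v ⟦ H ⟧ ≢ + 2 → h js ≢ 1
  h≢1 v≢2 eq = v≢2 (trans (v-loops ls) (cong (λ x → + (2 * x)) eq))

  v-G : ∀ {x} → g js ≡ x → v ⟦ G ⟧ ≡ + (1 + 2 * x)
  v-G eq = trans (v-3+loops ls) (cong (λ x → + (1 + 2 * x)) eq)

  part-a : + 2 ≤ c → v ⟦ G ⟧ ≡ c
  part-a 2≤c = trans (v-3+loops ls) (ℤGroup.∙-cancelʳ (+ (4 * N)) _ c (trans (cong +_ (begin
    1 + 2 * g js + 4 * N          ≡⟨ lemma₁ (g js) N ⟩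
    1 + 2 * (g js + 2 * N)        ≡⟨ cong (λ x → 1 + 2 * x) (g-controlled js lt) ⟩
    1 + 2 * (2 + total js)        ≡⟨ cong (λ t → 1 + 2 * (2 + t)) total-js ⟩
    1 + 2 * (2 + sum ks)          ≡⟨ lemma₂ (sum ks) ⟩
    5 + 2 * sum ks                ∎)) (sym c≡)))
    where
    open ≡-Reasoning
    lt : 2 * N < 2 + total js
    lt = subst (λ t → 2 * N < 2 + t) (sym total-js) (controlled 2≤c)
    lemma₁ : ∀ x n → 1 + 2 * x + 4 * n ≡ 1 + 2 * (x + 2 * n)
    lemma₁ = solve-∀
    lemma₂ : ∀ t → 1 + 2 * (2 + t) ≡ 5 + 2 * t
    lemma₂ = solve-∀

  part-b : c ≤ + 1 → v ⟦ H ⟧ ≡ + 2 → v ⟦ G ⟧ ≡ + 1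
  -- `H` has value 2 exactly when `h` is 1, and opening the chain then costs `1 + 2 * χ 1 = 1`.
  part-b _ v≡2 = v-G (g-h≡1 js (*-cancelˡ-≡ _ 1 2 (ℤ.+-injective (trans (sym (v-loops ls)) v≡2))))

  uncontrolled-js : c ≤ + 1 → 2 + total js ≤ℕ 2 * N
  uncontrolled-js c≤1 = subst (λ t → 2 + t ≤ℕ 2 * N) (sym total-js) (uncontrolled c≤1)

  part-c : c ≤ + 1 → v ⟦ H ⟧ ≢ + 2 → #fourLoops H ≡ 0 → v ⟦ G ⟧ ≡ + 3
  part-c c≤1 v≢2 f≡0 = v-G (g-no-fours js (uncontrolled-js c≤1) (h≢1 v≢2) (no-fours js
    (trans (cong fours (Vec.toList∘fromList ks)) (trans (sym (fours-half ls)) f≡0))))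

  gK = g (fromList (others ks))

  bit-G : c ≤ + 1 → v ⟦ H ⟧ ≢ + 2 → v ⟦ G ⟧ ≡ + (1 + 2 * bit (gK + 2 * #fourLoops H))
  bit-G c≤1 v≢2 = v-G (begin
    g js                          ≡⟨ g-greedy js (h≢1 v≢2) ⟩
    greedyValue (toList js)       ≡⟨ cong greedyValue (Vec.toList∘fromList ks) ⟩
    iterate-φ gK f                ≡⟨ iterate-φ-bit gK f (g-others-≤ ks (uncontrolled c≤1)) ⟩
    bit (gK + 2 * f)              ≡⟨ cong (λ f → bit (gK + 2 * f)) (fours-half ls) ⟨
    bit (gK + 2 * #fourLoops H)   ∎)
    where open ≡-Reasoning

  bit-f-odd : ¬ (2 ∣ #fourLoops H) → bit (gK + 2 * #fourLoops H) ≡ bit (2 + gK)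
  -- An odd number `1 + m * 2` of 4-loops shifts the argument by `2 + 4 * m`, where `4 * m` is a
  -- multiple of the period.
  bit-f-odd ¬2∣f with m , eq ← odd _ ¬2∣f =
    trans (cong (λ f → bit (gK + 2 * f)) eq) (trans (cong bit (lemma gK m)) (bit-+4* (2 + gK) m))
    where
    lemma : ∀ x m → x + 2 * (1 + m * 2) ≡ 2 + x + 4 * m
    lemma = solve-∀

  bit-f-even : 2 ∣ #fourLoops H → bit (gK + 2 * #fourLoops H) ≡ bit gK
  bit-f-even (divides m eq) =
    trans (cong (λ f → bit (gK + 2 * f)) eq) (trans (cong bit (lemma gK m)) (bit-+4* gK m))
    where
    lemma : ∀ x m → x + 2 * (m * 2) ≡ x + 4 * m
    lemma = solve-∀

  part-d : c ≤ + 1 → v ⟦ H ⟧ ≢ + 2 → 1 ≤ℕ #fourLoops H →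
           let d = v ⟦ withoutFourLoops G ⟧ %ℕ 8 in
           (¬ (2 ∣ #fourLoops H) → v ⟦ G ⟧ ≡ + ∣ + 4 - + d ∣) ×
           (2 ∣ #fourLoops H → v ⟦ G ⟧ ≡ + 4 - + ∣ + 4 - + d ∣)
  part-d c≤1 v≢2 _ =
    (λ ¬2∣f → trans (bit-G c≤1 v≢2) (trans (cong (λ y → + (1 + 2 * y)) (bit-f-odd ¬2∣f))
      (trans (bit-odd gK) (cong (λ w → + ∣ + 4 - + (w %ℕ 8) ∣) (sym v-M))))) ,
    (λ 2∣f → trans (bit-G c≤1 v≢2) (trans (cong (λ y → + (1 + 2 * y)) (bit-f-even 2∣f))
      (trans (bit-even gK) (cong (λ w → + 4 - + ∣ + 4 - + (w %ℕ 8) ∣) (sym v-M)))))
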